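{- Let $\mathsf{M}$ be a simple matroid on $[n]$ without singleton components, $K$ a field, $E=K\langle e_1,\dots,e_n\rangle$ and $J$ the Orlik–Solomon ideal of $\mathsf{M}$. If $J$ has linear relations, then $\mathsf{M}$ is connected.
   Context: A matroid on $[n]$ is a nonempty family of subsets of $[n]$ (independent sets) containing $\emptyset$, closed under subsets, satisfying the exchange axiom; other subsets are dependent, minimal dependent sets are circuits. A loop is an $i$ with $\{i\}$ dependent; $i,j$ are parallel if $\{i,j\}$ is a circuit; $\mathsf{M}$ is simple if it has no loops and no pair of parallel elements. The connected components are the equivalence classes of $x\sim y$ iff $x=y$ or some circuit contains both; a singleton component is a component with one element; $\mathsf{M}$ is connected if it has exactly one component. $E$ is the standard graded exterior algebra; for $S=\{i_0<\dots<i_m\}$, $e_S=e_{i_0}\wedge\dots\wedge e_{i_m}$ and $\partial e_S=\sum_{j=0}^m(-1)^je_{S\setminus\{i_j\}}$; the Orlik–Solomon ideal is $J=(\partial e_S:S\text{ dependent})$. A graded $E$-module has linear relations if it is generated in a single degree $m$ and its first syzygy module (in a minimal graded free presentation) is generated in degree $m+1$, i.e. $\dim_K\operatorname{Tor}^E_0(K,J)_j=0$ for $j\ne m$ and $\dim_K\operatorname{Tor}^E_1(K,J)_j=0$ for $j\neq m+1$. -}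

module Defs where

open import Level using (Level; _⊔_) renaming (suc to lsuc; zero to lzero)
open import Data.Nat using (ℕ; zero; suc; _<_; _≤_)
open import Data.Bool using (Bool; true; false; if_then_else_; _∧_; T)
open import Data.Fin using (Fin)
import Data.Fin.Subset
open import Data.Fin.Subset using (Subset; ⊥; ⁅_⁆; _∈_; _∉_; _⊆_; _⊂_; _∪_; _∩_; ∣_∣; inside; outside)
open import Data.Vec using (Vec; []; _∷_; lookup)
open import Data.Vec.Properties using (≡-dec)
import Data.Bool.Properties as BoolP
open import Data.List using (List; []; _∷_; _++_; map; foldr; allFin)
open import Data.List.Relation.Unary.All using (All)
open import Data.Product using (Σ; ∃; _×_; _,_; proj₁; proj₂)
open import Relation.Nullary using (¬_; does)
open import Relation.Binary.PropositionalEquality using (_≡_)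
open import Algebra.Bundles using (CommutativeRing)

record Field (c ℓ : Level) : Set (lsuc (c ⊔ ℓ)) where
  field
    commutativeRing : CommutativeRing c ℓ
  open CommutativeRing commutativeRing public
  field
    0≉1     : ¬ (0# ≈ 1#)
    inverse : ∀ x → ¬ (x ≈ 0#) → ∃ λ y → (x * y) ≈ 1#

record Matroid (n : ℕ) : Set where
  field
    indep       : Subset n → Bool
    empty-indep : indep ⊥ ≡ true
    hereditary  : ∀ {A B} → A ⊆ B → indep B ≡ true → indep A ≡ true
    exchange    : ∀ {A B} → indep A ≡ true → indep B ≡ true → ∣ A ∣ < ∣ B ∣ →
                  ∃ λ x → x ∈ B × x ∉ A × indep (A ∪ ⁅ x ⁆) ≡ true

module _ {n : ℕ} (M : Matroid n) where
  open Matroid M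

  Independent : Subset n → Set
  Independent A = indep A ≡ true

  Dependent : Subset n → Set
  Dependent A = indep A ≡ false

  Circuit : Subset n → Set
  Circuit C = Dependent C × (∀ D → D ⊂ C → Independent D)

  Loop : Fin n → Set
  Loop i = Dependent ⁅ i ⁆

  Parallel : Fin n → Fin n → Set
  Parallel i j = ¬ (i ≡ j) × Circuit (⁅ i ⁆ ∪ ⁅ j ⁆)

  Simple : Set
  Simple = (∀ i → ¬ Loop i) × (∀ i j → ¬ Parallel i j)

  _∼_ : Fin n → Fin n → Set
  x ∼ y = (x ≡ y) ⊎' (∃ λ C → Circuit C × x ∈ C × y ∈ C)
    where
    open import Data.Sum using () renaming (_⊎_ to _⊎'_)

  SingletonComponent : Fin n → Set
  SingletonComponent i = ∀ j → i ∼ j → j ≡ i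

  NoSingletonComponents : Set
  NoSingletonComponents = ∀ i → ¬ SingletonComponent i

  Connected : Set
  Connected = Fin n × (∀ x y → x ∼ y)

allSubsets : (n : ℕ) → List (Subset n)
allSubsets zero    = [] ∷ []
allSubsets (suc n) = map (outside ∷_) (allSubsets n) ++ map (inside ∷_) (allSubsets n)

inversions : {n : ℕ} → Subset n → Subset n → ℕ
inversions []      []      = 0
inversions (s ∷ S) (t ∷ T) = (if t then ∣ S ∣ else 0) Data.Nat.+ inversions S T

private
  ok : Bool → Bool → Bool → Bool
  ok false false false = true
  ok true  false true  = true
  ok false true  true  = true
  ok _     _     _     = false

fits : {n : ℕ} → Subset n → Subset n → Subset n → Bool
fits []      []      []      = true
fits (s ∷ S) (t ∷ T) (u ∷ U) = ok s t u ∧ fits S T U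

below : {n : ℕ} → Fin n → Subset n
below Fin.zero    = ⊥
below (Fin.suc i) = inside ∷ below i

-- The exterior algebra E = K⟨e₁,…,eₙ⟩, elements written as coefficient
-- functions on the basis {e_S : S ⊆ [n]}.

module Exterior {c ℓ : Level} (K : Field c ℓ) (n : ℕ) where
  open Field K

  Elem : Set c
  Elem = Subset n → Carrier

  _≈ₑ_ : Elem → Elem → Set ℓ
  x ≈ₑ y = ∀ S → x S ≈ y S

  0ₑ : Elem
  0ₑ _ = 0#

  _+ₑ_ : Elem → Elem → Elem
  (x +ₑ y) S = x S + y S

  _·_ : Carrier → Elem → Elem
  (k · x) S = k * x S

  sumK : {a : Level} {A : Set a} → List A → (A → Carrier) → Carrier
  sumK xs f = foldr (λ a r → f a + r) 0# xs

  sumE : {a : Level} {A : Set a} → List A → (A → Elem) → Elem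
  sumE xs f = foldr (λ a r → f a +ₑ r) 0ₑ xs

  sumFin : (r : ℕ) → (Fin r → Elem) → Elem
  sumFin r f = sumE (allFin r) f

  sgn : ℕ → Carrier
  sgn zero    = 1#
  sgn (suc k) = - sgn k

  e : Subset n → Elem
  e S T = if does (≡-dec BoolP._≟_ S T) then 1# else 0#

  -- wedge product: e_S ∧ e_T = (-1)^{inv(S,T)} e_{S∪T} if S∩T=∅, else 0
  _∧ₑ_ : Elem → Elem → Elem
  (x ∧ₑ y) U = sumK (allSubsets n) λ S → sumK (allSubsets n) λ T →
                 if fits S T U then sgn (inversions S T) * (x S * y T) else 0#

  -- ∂ e_S = Σ_j (-1)^j e_{S∖{i_j}} for S = {i₀ < … < i_m}
  ∂e : Subset n → Elem
  ∂e S = sumE (allFin n) λ i →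
           if lookup S i then sgn ∣ S ∩ below i ∣ · e (S Data.Fin.Subset.- i) else 0ₑ

  Hom : ℕ → Elem → Set ℓ
  Hom d x = ∀ S → ¬ (∣ S ∣ ≡ d) → x S ≈ 0#

  module OS (M : Matroid n) where

    InJ : Elem → Set (c ⊔ ℓ)
    InJ x = Σ (List (Elem × Subset n × Elem)) λ ts →
              All (λ t → Dependent M (proj₁ (proj₂ t))) ts ×
              (x ≈ₑ sumE ts (λ t → proj₁ t ∧ₑ (∂e (proj₁ (proj₂ t)) ∧ₑ proj₂ (proj₂ t))))

    -- A minimal graded free presentation  ⊕_{i<r} E(-m) → J → 0,
    -- eᵢ ↦ gen i, of J generated in the single degree m, whose first
    -- syzygy module is generated in degree m+1 (i.e. by syzygies whose
    -- coordinates are homogeneous of degree 1).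
    record LinearRelations : Set (lsuc lzero ⊔ c ⊔ ℓ) where
      field
        m r      : ℕ
        gen      : Fin r → Elem
      Syz : (Fin r → Elem) → Set ℓ
      Syz a = sumFin r (λ i → a i ∧ₑ gen i) ≈ₑ 0ₑ
      field
        gen-hom   : ∀ i → Hom m (gen i)
        gen-in-J  : ∀ i → InJ (gen i)
        generates : ∀ x → InJ x → ∃ λ (a : Fin r → Elem) → x ≈ₑ sumFin r (λ i → a i ∧ₑ gen i)
        -- minimality: the syzygy module lies in E₊·F
        minimal   : ∀ a → Syz a → ∀ i → a i ⊥ ≈ 0#
        syz-linear : ∀ a → Syz a →
          ∃ λ (k : ℕ) → ∃ λ (coef : Fin k → Elem) → ∃ λ (s : Fin k → Fin r → Elem) →
            (∀ j → Syz (s j)) × (∀ j i → Hom 1 (s j i)) ×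
            (∀ i → a i ≈ₑ sumFin k (λ j → coef j ∧ₑ s j i))

{-# OPTIONS --safe #-}

-- Let J have linear relations with generators gᵢ of degree m. Every dependent
-- set has at least m + 1 elements, those with exactly m + 1 are circuits, and
-- each component that contains a circuit contains one of size m + 1. Circuits
-- do not cross components, so for a component A an element of J of degree m
-- splits into a part supported inside A and a part supported outside A. Let gᵢ′
-- be the part of gᵢ inside A. As m ≥ 2 for simple M, comparing bidegrees shows
-- Σ sᵢ ∧ gᵢ′ = 0 for every linear syzygy s, hence for every syzygy. If there
-- were circuits S₁ inside A and S₂ outside A of size m + 1, writing f = ∂e S₁
-- and h = ∂e S₂ through the gᵢ turns h ∧ f = ± f ∧ h into a syzygy for which
-- this sum is h ∧ f ≠ 0.

module Submission where

open import Defs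
import Algebra.Properties.CommutativeSemigroup as CommutativeSemigroupProperties
import Algebra.Properties.Ring as RingProperties
open import Data.Bool using (true; false; if_then_else_)
import Data.Bool.Properties as Bool
open import Data.Empty using (⊥-elim)
open import Data.Fin using (Fin; zero; suc)
import Data.Fin.Properties as Fin
open import Data.Fin.Subset
open import Data.Fin.Subset.Properties
open import Data.List using (List; []; _∷_; _++_; map; foldr; allFin)
open import Data.List.Membership.Propositional using () renaming (_∈_ to _∈ˡ_)
open import Data.List.Membership.Propositional.Properties
  using (∈-map⁺; ∈-++⁺ˡ; ∈-++⁺ʳ; ∈-map⁻; ∈-allFin)
open import Data.List.Relation.Unary.All using (All; []; _∷_)
open import Data.List.Relation.Unary.AllPairs using ([]; _∷_)
open import Data.List.Relation.Unary.Any using (here; there)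
open import Data.List.Relation.Unary.Unique.Propositional using (Unique)
import Data.List.Relation.Unary.Unique.Propositional.Properties as Unique
open import Data.Nat as ℕ using (ℕ; zero; suc; _∸_; _≤_; _<_; z≤n; s≤s)
open import Data.Nat.Induction using (<-wellFounded)
import Data.Nat.Properties as ℕ
open import Data.Product using (∃; _×_; _,_; proj₁; proj₂)
open import Data.Sum using (_⊎_; inj₁; inj₂; [_,_]′)
open import Data.Vec using ([]; _∷_; lookup; here; there; tabulate)
import Data.Vec.Properties as Vec
open import Induction.WellFounded using (Acc; acc)
open import Level using (Level)
open import Relation.Binary.PropositionalEquality
  using (_≡_; _≢_; refl; sym; trans; cong; cong₂; subst; module ≡-Reasoning)
open import Relation.Nullary using (¬_; Dec; yes; no; does; contradiction; ¬?)
open import Relation.Nullary.Decidable using (_×-dec_; _⊎-dec_; dec-true; dec-false; decidable-stable)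

-- What rules out two separated circuits is the Koszul syzygy that equates the two orders of
-- `h ∧ f`. Its coefficients have degree `m`, and it couples generators that live on different parts
-- of the ground set. A linear syzygy cannot couple them: each generator is a sum of pieces with
-- either 0 or `m` elements outside `A`, and a coefficient of degree 1 raises that count by at most
-- one. The counts 0, 1 and `m`, `m + 1` are disjoint because `m` is at least 2, so the relation
-- already holds for the inner pieces alone. Equality in `K` is not assumed decidable.
-- Contradictions over `K` therefore always come from a coefficient that is a product of signs,
-- hence a unit, while circuits and components are found by searching the finitely many subsets.

-- Finite subsets.

module _ {n : ℕ} where

  ∈--⁻ : ∀ {x} (p : Subset n) y → x ∈ p - y → x ∈ p × x ≢ y
  ∈--⁻ p y x∈ = p─q⊆p p ⁅ y ⁆ x∈ , λ { refl → x∉p-x p y x∈ }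
    where
    x∉p-x : ∀ {k} (q : Subset k) z → z ∉ q - z
    x∉p-x (_ ∷ q) zero    ()
    x∉p-x (_ ∷ q) (suc z) (there z∈) = x∉p-x q z z∈

  ∪-lub : ∀ {p q r : Subset n} → p ⊆ r → q ⊆ r → p ∪ q ⊆ r
  ∪-lub {p} {q} p⊆r q⊆r x∈ = [ p⊆r , q⊆r ]′ (x∈p∪q⁻ p q x∈)

  ∪⁅⁆-lub : ∀ {p r : Subset n} {x} → p ⊆ r → x ∈ r → p ∪ ⁅ x ⁆ ⊆ r
  ∪⁅⁆-lub {r = r} {x} p⊆r x∈r =
    ∪-lub p⊆r λ y∈ → subst (_∈ r) (sym (x∈⁅y⁆⇒x≡y x y∈)) x∈r

  ⊆-∪⁅⁆ : ∀ {p q : Subset n} {x} → p - x ⊆ q → p ⊆ q ∪ ⁅ x ⁆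
  ⊆-∪⁅⁆ {x = x} p-x⊆q {y} y∈p with y Fin.≟ x
  ... | yes refl = x∈p∪q⁺ (inj₂ (x∈⁅x⁆ x))
  ... | no y≢x   = x∈p∪q⁺ (inj₁ (p-x⊆q (x∈p∧x≢y⇒x∈p-y y∈p y≢x)))

  ⊂-∪⁅⁆ : ∀ {p : Subset n} {x} → x ∉ p → p ⊂ p ∪ ⁅ x ⁆
  ⊂-∪⁅⁆ {p} {x} x∉p = p⊆p∪q ⁅ x ⁆ , x , q⊆p∪q p ⁅ x ⁆ (x∈⁅x⁆ x) , x∉p

  ⊆⊎∃∉ : ∀ (p q : Subset n) → p ⊆ q ⊎ (∃ λ x → x ∈ p × x ∉ q)
  ⊆⊎∃∉ p q with Fin.any? (λ x → x ∈? p ×-dec ¬? (x ∈? q))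
  ... | yes w = inj₂ w
  ... | no ¬w = inj₁ λ {x} x∈p → decidable-stable (x ∈? q) λ x∉q → ¬w (x , x∈p , x∉q)

suc∣p-x∣≡∣p∣ : ∀ {n x} {p : Subset n} → x ∈ p → suc ∣ p - x ∣ ≡ ∣ p ∣
suc∣p-x∣≡∣p∣ {p = _ ∷ p}       here       = cong suc (cong ∣_∣ (p─⊥≡p p))
suc∣p-x∣≡∣p∣ {p = inside  ∷ p} (there x∈) = cong suc (suc∣p-x∣≡∣p∣ x∈)
suc∣p-x∣≡∣p∣ {p = outside ∷ p} (there x∈) = suc∣p-x∣≡∣p∣ x∈

-- Matroids

module _ {n : ℕ} (M : Matroid n) where
  open Matroid M

  private
    Indep Dep Circ : Subset n → Set
    Indep = Independent M
    Dep   = Dependent M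
    Circ  = Circuit M

  dependent⊎independent : ∀ S → Dep S ⊎ Indep S
  dependent⊎independent S with indep S
  ... | true  = inj₂ refl
  ... | false = inj₁ refl

  ¬dependent∧independent : ∀ {S} → Dep S → ¬ Indep S
  ¬dependent∧independent d i with () ← trans (sym d) i

  dependent-⊆ : ∀ {A B} → A ⊆ B → Dep A → Dep B
  dependent-⊆ {A} {B} A⊆B d with dependent⊎independent B
  ... | inj₁ dB = dB
  ... | inj₂ iB = ⊥-elim (¬dependent∧independent d (hereditary A⊆B iB))

  dependent-nonempty : ∀ {S} → Dep S → Nonempty S
  dependent-nonempty {S} d with nonempty? S
  ... | yes ne = ne
  ... | no ¬ne = ⊥-elim (¬dependent∧independent (subst Dep (Empty-unique ¬ne) d) empty-indep)

  circuit⊆dependent : ∀ {S} → Dep S → ∃ λ C → Circ C × C ⊆ S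
  circuit⊆dependent {S} = go S (<-wellFounded _)
    where
    go : ∀ T → Acc _<_ ∣ T ∣ → Dep T → ∃ λ C → Circ C × C ⊆ T
    go T (acc rec) d with anySubset? (λ D → D ⊂? T ×-dec indep D Bool.≟ false)
    ... | yes (D , D⊂T , dD) =
          let C , c , C⊆D = go D (rec (p⊂q⇒∣p∣<∣q∣ D⊂T)) dD
          in  C , c , ⊆-trans C⊆D (p⊂q⇒p⊆q D⊂T)
    ... | no ¬D = T , (d , λ D D⊂T → [ (λ dD → ⊥-elim (¬D (D , D⊂T , dD))) , (λ i → i) ]′
                                       (dependent⊎independent D)) , ⊆-refl

  circuit-minimal : ∀ {C D} → Circ C → Circ D → C ⊆ D → D ⊆ C
  circuit-minimal {C} {D} (dC , _) (_ , minD) C⊆D with ⊆⊎∃∉ D C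
  ... | inj₁ D⊆C = D⊆C
  ... | inj₂ w   = ⊥-elim (¬dependent∧independent dC (minD C (C⊆D , w)))

  circuit-minus : ∀ {C x} → Circ C → x ∈ C → Indep (C - x)
  circuit-minus (_ , minC) x∈C = minC _ (x∈p⇒p-x⊂p x∈C)

  -- Greedy augmentation inside `X`. Maximality is recorded as dependence of every one-element
  -- extension, which is what an application of `exchange` contradicts.
  extend-independent : ∀ {I X} → I ⊆ X → Indep I →
    ∃ λ J → I ⊆ J × J ⊆ X × Indep J × (∀ z → z ∈ X → z ∉ J → Dep (J ∪ ⁅ z ⁆))
  extend-independent {I} {X} = go I (<-wellFounded _)
    where
    go : ∀ I → Acc _<_ (n ∸ ∣ I ∣) → I ⊆ X → Indep I →
         ∃ λ J → I ⊆ J × J ⊆ X × Indep J × (∀ z → z ∈ X → z ∉ J → Dep (J ∪ ⁅ z ⁆))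
    go I (acc rec) I⊆X iI
      with Fin.any? (λ z → z ∈? X ×-dec (¬? (z ∈? I) ×-dec indep (I ∪ ⁅ z ⁆) Bool.≟ true))
    ... | yes (z , z∈X , z∉I , i) =
          let J , I∪z⊆J , rest = go (I ∪ ⁅ z ⁆)
                (rec (ℕ.∸-monoʳ-< (p⊂q⇒∣p∣<∣q∣ (⊂-∪⁅⁆ z∉I)) (∣p∣≤n (I ∪ ⁅ z ⁆))))
                (∪⁅⁆-lub I⊆X z∈X) i
          in  J , ⊆-trans (p⊆p∪q ⁅ z ⁆) I∪z⊆J , rest
    ... | no ¬z = I , ⊆-refl , I⊆X , iI , λ z z∈X z∉I →
          [ (λ d → d) , (λ i → ⊥-elim (¬z (z , z∈X , z∉I , i))) ]′ (dependent⊎independent _)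

  -- Any maximal independent subset I ⊇ C₂ - e of (C₁ ∪ C₂) - e - f spans
  -- e, hence C₁ - f, hence f.
  strong-elimination : ∀ {C₁ C₂ e f} → Circ C₁ → Circ C₂ →
    e ∈ C₁ → e ∈ C₂ → f ∈ C₁ → f ∉ C₂ →
    ∃ λ C → Circ C × f ∈ C × e ∉ C × C ⊆ C₁ ∪ C₂
  strong-elimination {C₁} {C₂} {e} {f} c₁ c₂ e∈C₁ e∈C₂ f∈C₁ f∉C₂ =
    [ fromDependent , (λ i → ⊥-elim (¬independent i)) ]′ (dependent⊎independent (I ∪ ⁅ f ⁆))
    where
    U X : Subset n
    U = C₁ ∪ C₂
    X = U - e - f

    C₂-e⊆X : C₂ - e ⊆ X
    C₂-e⊆X {x} x∈ = let x∈C₂ , x≢e = ∈--⁻ C₂ e x∈ in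
      x∈p∧x≢y⇒x∈p-y (x∈p∧x≢y⇒x∈p-y (q⊆p∪q C₁ C₂ x∈C₂) x≢e) λ { refl → f∉C₂ x∈C₂ }

    C₁-f⊆U-f : C₁ - f ⊆ U - f
    C₁-f⊆U-f x∈ = let x∈C₁ , x≢f = ∈--⁻ C₁ f x∈ in x∈p∧x≢y⇒x∈p-y (p⊆p∪q C₂ x∈C₁) x≢f

    extI = extend-independent C₂-e⊆X (circuit-minus c₂ e∈C₂)
    extK = extend-independent C₁-f⊆U-f (circuit-minus c₁ f∈C₁)

    I K : Subset n
    I = proj₁ extI
    K = proj₁ extK

    I⊆X : I ⊆ X
    I⊆X = proj₁ (proj₂ (proj₂ extI))
    K⊆U-f : K ⊆ U - f
    K⊆U-f = proj₁ (proj₂ (proj₂ extK))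

    I∪e-dependent : Dep (I ∪ ⁅ e ⁆)
    I∪e-dependent = dependent-⊆ (⊆-∪⁅⁆ (proj₁ (proj₂ extI))) (proj₁ c₂)
    K∪f-dependent : Dep (K ∪ ⁅ f ⁆)
    K∪f-dependent = dependent-⊆ (⊆-∪⁅⁆ (proj₁ (proj₂ extK))) (proj₁ c₁)

    f∉I : f ∉ I
    f∉I f∈I = proj₂ (∈--⁻ (U - e) f (I⊆X f∈I)) refl

    ∈X⇒∈U-f : ∀ {x} → x ∈ X → x ∈ U - f
    ∈X⇒∈U-f x∈X = let x∈U-e , x≢f = ∈--⁻ (U - e) f x∈X
                  in x∈p∧x≢y⇒x∈p-y (proj₁ (∈--⁻ U e x∈U-e)) x≢f

    -- The spanning argument becomes a comparison of sizes. If `K` is smaller than `I ∪ ⁅ f ⁆`,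
    -- exchange enlarges `K` by `f` or by an element of `I`; otherwise `K` is larger than `I`, and
    -- exchange enlarges `I` by `e` or by an element of `X`. All four extensions are dependent.
    ¬independent : ¬ Indep (I ∪ ⁅ f ⁆)
    ¬independent iI∪f with ∣ K ∣ ℕ.<? ∣ I ∪ ⁅ f ⁆ ∣
    ... | yes K<I∪f with exchange (proj₁ (proj₂ (proj₂ (proj₂ extK)))) iI∪f K<I∪f
    ...   | z , z∈ , z∉K , i with x∈p∪q⁻ I ⁅ f ⁆ z∈
    ...     | inj₁ z∈I = ¬dependent∧independent
                (proj₂ (proj₂ (proj₂ (proj₂ extK))) z (∈X⇒∈U-f (I⊆X z∈I)) z∉K) i
    ...     | inj₂ z∈f with refl ← x∈⁅y⁆⇒x≡y f z∈f = ¬dependent∧independent K∪f-dependent i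
    ¬independent iI∪f | no K≮I∪f
      with exchange (proj₁ (proj₂ (proj₂ (proj₂ extI)))) (proj₁ (proj₂ (proj₂ (proj₂ extK))))
                    (ℕ.<-≤-trans (p⊂q⇒∣p∣<∣q∣ (⊂-∪⁅⁆ f∉I)) (ℕ.≮⇒≥ K≮I∪f))
    ...   | z , z∈K , z∉I , i with z Fin.≟ e
    ...     | yes refl = ¬dependent∧independent I∪e-dependent i
    ...     | no z≢e =
                let z∈U , z≢f = ∈--⁻ U f (K⊆U-f z∈K)
                    z∈X = x∈p∧x≢y⇒x∈p-y (x∈p∧x≢y⇒x∈p-y z∈U z≢e) z≢f
                in  ¬dependent∧independent (proj₂ (proj₂ (proj₂ (proj₂ extI))) z z∈X z∉I) i

    fromDependent : Dep (I ∪ ⁅ f ⁆) → ∃ λ C → Circ C × f ∈ C × e ∉ C × C ⊆ U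
    fromDependent d with circuit⊆dependent d
    ... | C , c , C⊆ = C , c , f∈C , e∉C , λ x∈C → proj₁ (∈U∖e x∈C)
      where
      f∈C : f ∈ C
      f∈C = decidable-stable (f ∈? C) λ f∉C → ¬dependent∧independent
        (dependent-⊆ (λ {x} x∈C → [ (λ x∈I → x∈I)
                                  , (λ x∈f → ⊥-elim (f∉C (subst (_∈ C) (x∈⁅y⁆⇒x≡y f x∈f) x∈C))) ]′
                                  (x∈p∪q⁻ I ⁅ f ⁆ (C⊆ x∈C))) (proj₁ c))
        (proj₁ (proj₂ (proj₂ (proj₂ extI))))
      ∈U∖e : ∀ {x} → x ∈ C → x ∈ U × x ≢ e
      ∈U∖e x∈C with x∈p∪q⁻ I ⁅ f ⁆ (C⊆ x∈C)
      ... | inj₁ x∈I = ∈--⁻ U e (proj₁ (∈--⁻ (U - e) f (I⊆X x∈I)))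
      ... | inj₂ x∈f with refl ← x∈⁅y⁆⇒x≡y f x∈f = p⊆p∪q C₂ f∈C₁ , λ { refl → f∉C₂ e∈C₂ }
      e∉C : e ∉ C
      e∉C e∈C = proj₂ (∈U∖e e∈C) refl

  -- Connected components.

  -- This is the transitivity of `∼`, by induction on the size of `C₁ ∪ C₂`. Eliminating `e` gives
  -- `C₃` through `x` and `C₄` through `z`. By minimality of circuits `C₃` leaves `C₁` at some `w`
  -- in `C₂`, and `C₄` leaves `C₂` at some `v` in `C₁`. If `v` lies in `C₃`, then `C₃` and `C₄` meet
  -- and their union misses `e`; if not, `C₃` and `C₂` meet in `w` and their union misses `v`.
  circuit-joining : ∀ {C₁ C₂ e x z} → Circ C₁ → Circ C₂ → e ∈ C₁ → e ∈ C₂ →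
    x ∈ C₁ → z ∈ C₂ → ∃ λ C → Circ C × x ∈ C × z ∈ C
  circuit-joining {C₁} {C₂} {x = x} {z} = go C₁ C₂ (<-wellFounded _)
    where
    go : ∀ C₁ C₂ → Acc _<_ ∣ C₁ ∪ C₂ ∣ → ∀ {e} → Circ C₁ → Circ C₂ →
         e ∈ C₁ → e ∈ C₂ → x ∈ C₁ → z ∈ C₂ → ∃ λ C → Circ C × x ∈ C × z ∈ C
    go C₁ C₂ (acc rec) {e} c₁ c₂ e∈C₁ e∈C₂ x∈C₁ z∈C₂ with x ∈? C₂ | z ∈? C₁
    ... | yes x∈C₂ | _        = C₂ , c₂ , x∈C₂ , z∈C₂
    ... | no _     | yes z∈C₁ = C₁ , c₁ , x∈C₁ , z∈C₁
    ... | no x∉C₂  | no z∉C₁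
      with strong-elimination c₁ c₂ e∈C₁ e∈C₂ x∈C₁ x∉C₂
         | strong-elimination c₂ c₁ e∈C₂ e∈C₁ z∈C₂ z∉C₁
    ...   | C₃ , c₃ , x∈C₃ , e∉C₃ , C₃⊆ | C₄ , c₄ , z∈C₄ , e∉C₄ , C₄⊆
      with ⊆⊎∃∉ C₃ C₁ | ⊆⊎∃∉ C₄ C₂
    ...     | inj₁ C₃⊆C₁ | _ = ⊥-elim (e∉C₃ (circuit-minimal c₃ c₁ C₃⊆C₁ e∈C₁))
    ...     | inj₂ _     | inj₁ C₄⊆C₂ = ⊥-elim (e∉C₄ (circuit-minimal c₄ c₂ C₄⊆C₂ e∈C₂))
    ...     | inj₂ (w , w∈C₃ , w∉C₁) | inj₂ (v , v∈C₄ , v∉C₂) with v ∈? C₃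
    ...       | yes v∈C₃ = go C₃ C₄ (rec (p⊂q⇒∣p∣<∣q∣ C₃∪C₄⊂)) c₃ c₄ v∈C₃ v∈C₄ x∈C₃ z∈C₄
      where
      C₃∪C₄⊂ : C₃ ∪ C₄ ⊂ C₁ ∪ C₂
      C₃∪C₄⊂ = ∪-lub C₃⊆ (λ y∈ → subst (_ ∈_) (∪-comm C₂ C₁) (C₄⊆ y∈)) ,
               e , p⊆p∪q C₂ e∈C₁ , λ e∈ → [ e∉C₃ , e∉C₄ ]′ (x∈p∪q⁻ C₃ C₄ e∈)
    ...       | no v∉C₃ = go C₃ C₂ (rec (p⊂q⇒∣p∣<∣q∣ C₃∪C₂⊂)) c₃ c₂ w∈C₃
                             ([ (λ w∈C₁ → ⊥-elim (w∉C₁ w∈C₁)) , (λ w∈C₂ → w∈C₂) ]′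
                               (x∈p∪q⁻ C₁ C₂ (C₃⊆ w∈C₃))) x∈C₃ z∈C₂
      where
      C₃∪C₂⊂ : C₃ ∪ C₂ ⊂ C₁ ∪ C₂
      C₃∪C₂⊂ = ∪-lub C₃⊆ (q⊆p∪q C₁ C₂) , v ,
               subst (v ∈_) (∪-comm C₂ C₁) (C₄⊆ v∈C₄) ,
               λ v∈ → [ v∉C₃ , v∉C₂ ]′ (x∈p∪q⁻ C₃ C₂ v∈)

  private
    infix 4 _≈ᶜ_
    _≈ᶜ_ : Fin n → Fin n → Set
    _≈ᶜ_ = _∼_ M

  circuit⇒∼ : ∀ {C x y} → Circ C → x ∈ C → y ∈ C → x ≈ᶜ y
  circuit⇒∼ c x∈C y∈C = inj₂ (_ , c , x∈C , y∈C)

  ∼-sym : ∀ {x y} → x ≈ᶜ y → y ≈ᶜ x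
  ∼-sym (inj₁ eq)                  = inj₁ (sym eq)
  ∼-sym (inj₂ (C , c , x∈C , y∈C)) = inj₂ (C , c , y∈C , x∈C)

  ∼-trans : ∀ {x y z} → x ≈ᶜ y → y ≈ᶜ z → x ≈ᶜ z
  ∼-trans (inj₁ refl) y∼z                       = y∼z
  ∼-trans x∼y@(inj₂ _) (inj₁ refl)              = x∼y
  ∼-trans (inj₂ (C , c , x∈C , y∈C)) (inj₂ (D , d , y∈D , z∈D)) =
    inj₂ (circuit-joining c d y∈C y∈D x∈C z∈D)

  circuit? : ∀ C → Dec (Circ C)
  circuit? C with dependent⊎independent C
  ... | inj₂ i = no λ c → ¬dependent∧independent (proj₁ c) i
  ... | inj₁ d with anySubset? (λ D → D ⊂? C ×-dec indep D Bool.≟ false)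
  ...   | yes (D , D⊂C , dD) = no λ c → ¬dependent∧independent dD (proj₂ c D D⊂C)
  ...   | no ¬D = yes (d , λ D D⊂C → [ (λ dD → ⊥-elim (¬D (D , D⊂C , dD))) , (λ i → i) ]′
                                       (dependent⊎independent D))

  -- A `Subset` is a Boolean vector, so a component becomes one only through this decision. It also
  -- lets connectedness be proved by refuting its negation.
  ∼-dec : ∀ x y → Dec (x ≈ᶜ y)
  ∼-dec x y = x Fin.≟ y ⊎-dec anySubset? (λ C → circuit? C ×-dec (x ∈? C ×-dec y ∈? C))

  component : Fin n → Subset n
  component x = tabulate λ y → does (∼-dec x y)

  component⁺ : ∀ {x y} → x ≈ᶜ y → y ∈ component x
  component⁺ {x} {y} x∼y = Vec.lookup⇒[]= y (component x)
    (trans (Vec.lookup∘tabulate _ y) (dec-true (∼-dec x y) x∼y))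

  component⁻ : ∀ {x y} → y ∈ component x → x ≈ᶜ y
  component⁻ {x} {y} y∈ with ∼-dec x y in eq
  ... | yes x∼y = x∼y
  ... | no _ with () ← trans (sym (Vec.[]=⇒lookup y∈)) (trans (Vec.lookup∘tabulate _ y) (cong does eq))

  -- The hypothesis only refutes isolation of `x`, so the circuit comes doubly negated. That is
  -- enough where the goal is a contradiction.
  non-singleton : NoSingletonComponents M → ∀ x → ¬ ¬ (∃ λ C → Circ C × x ∈ C)
  non-singleton no-singleton x ¬C = no-singleton x λ where
    j (inj₁ x≡j)               → sym x≡j
    j (inj₂ (C , c , x∈C , _)) → ⊥-elim (¬C (C , c , x∈C))

  -- A circuit inside `S` is nonempty; with one element it would be a loop, with two a parallel
  -- pair.
  simple⇒3≤∣dependent∣ : Simple M → ∀ {S} → Dep S → 3 ≤ ∣ S ∣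
  simple⇒3≤∣dependent∣ (¬loop , ¬parallel) dS with circuit⊆dependent dS
  ... | C , c@(dC , _) , C⊆S with dependent-nonempty dC
  ...   | i , i∈C with nonempty? (C - i)
  ...     | no C-i-empty = ⊥-elim (¬loop i (subst Dep C≡⁅i⁆ dC))
    where
    C≡⁅i⁆ : C ≡ ⁅ i ⁆
    C≡⁅i⁆ = ⊆-antisym
      (⊆-trans (⊆-∪⁅⁆ {q = ⊥} λ x∈ → ⊥-elim (C-i-empty (_ , x∈))) (⊆-reflexive (∪-identityˡ ⁅ i ⁆)))
      (λ x∈ → subst (_∈ C) (sym (x∈⁅y⁆⇒x≡y i x∈)) i∈C)
  ...     | yes (j , j∈C-i) with ∈--⁻ C i j∈C-i | nonempty? (C - i - j)
  ...       | j∈C , j≢i | no C-i-j-empty =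
    ⊥-elim (¬parallel j i (j≢i , subst Circ C≡⁅j⁆∪⁅i⁆ c))
    where
    C≡⁅j⁆∪⁅i⁆ : C ≡ ⁅ j ⁆ ∪ ⁅ i ⁆
    C≡⁅j⁆∪⁅i⁆ = ⊆-antisym
      (⊆-∪⁅⁆ (⊆-trans (⊆-∪⁅⁆ {q = ⊥} λ x∈ → ⊥-elim (C-i-j-empty (_ , x∈)))
                      (⊆-reflexive (∪-identityˡ ⁅ j ⁆))))
      (∪⁅⁆-lub (λ x∈ → subst (_∈ C) (sym (x∈⁅y⁆⇒x≡y j x∈)) j∈C) i∈C)
  ...       | j∈C , _ | yes (k , k∈) = ℕ.≤-trans 3≤∣C∣ (p⊆q⇒∣p∣≤∣q∣ C⊆S)
    where
    3≤∣C∣ : 3 ≤ ∣ C ∣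
    3≤∣C∣ = subst (3 ≤_)
      (trans (cong (2 ℕ.+_) (suc∣p-x∣≡∣p∣ k∈)) (trans (cong suc (suc∣p-x∣≡∣p∣ j∈C-i)) (suc∣p-x∣≡∣p∣ i∈C)))
      (s≤s (s≤s (s≤s z≤n)))

  minimum-dependent⇒circuit : ∀ {k} → (∀ {S} → Dep S → k ≤ ∣ S ∣) →
    ∀ {S} → Dep S → ∣ S ∣ ≡ k → Circ S
  minimum-dependent⇒circuit minimum dS refl = dS , λ D D⊂S →
    [ (λ dD → contradiction (minimum dD) (ℕ.<⇒≱ (p⊂q⇒∣p∣<∣q∣ D⊂S))) , (λ i → i) ]′
      (dependent⊎independent D)

-- Disjoint unions: fits S T U says U = S ⊔ T

fits-⊆ˡ : ∀ {n} (S T U : Subset n) → fits S T U ≡ true → S ⊆ U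
fits-⊆ˡ (true ∷ S)  (false ∷ T) (true ∷ U)  ok here       = here
fits-⊆ˡ (true ∷ S)  (false ∷ T) (true ∷ U)  ok (there x∈) = there (fits-⊆ˡ S T U ok x∈)
fits-⊆ˡ (false ∷ S) (false ∷ T) (false ∷ U) ok (there x∈) = there (fits-⊆ˡ S T U ok x∈)
fits-⊆ˡ (false ∷ S) (true ∷ T)  (true ∷ U)  ok (there x∈) = there (fits-⊆ˡ S T U ok x∈)

fits-comm : ∀ {n} (S T U : Subset n) → fits S T U ≡ fits T S U
fits-comm []          []          []          = refl
fits-comm (false ∷ S) (false ∷ T) (false ∷ U) = fits-comm S T U
fits-comm (false ∷ S) (false ∷ T) (true ∷ U)  = refl
fits-comm (false ∷ S) (true ∷ T)  (false ∷ U) = refl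
fits-comm (false ∷ S) (true ∷ T)  (true ∷ U)  = fits-comm S T U
fits-comm (true ∷ S)  (false ∷ T) (false ∷ U) = refl
fits-comm (true ∷ S)  (false ∷ T) (true ∷ U)  = fits-comm S T U
fits-comm (true ∷ S)  (true ∷ T)  (false ∷ U) = refl
fits-comm (true ∷ S)  (true ∷ T)  (true ∷ U)  = refl

fits-⊆ʳ : ∀ {n} (S T U : Subset n) → fits S T U ≡ true → T ⊆ U
fits-⊆ʳ S T U ok = fits-⊆ˡ T S U (trans (sym (fits-comm S T U)) ok)

fits-cover : ∀ {n} (S T U : Subset n) → fits S T U ≡ true → U ⊆ S ∪ T
fits-cover (true ∷ S)  (false ∷ T) (true ∷ U)  ok here       = here
fits-cover (false ∷ S) (true ∷ T)  (true ∷ U)  ok here       = here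
fits-cover (true ∷ S)  (false ∷ T) (true ∷ U)  ok (there x∈) = there (fits-cover S T U ok x∈)
fits-cover (false ∷ S) (true ∷ T)  (true ∷ U)  ok (there x∈) = there (fits-cover S T U ok x∈)
fits-cover (false ∷ S) (false ∷ T) (false ∷ U) ok (there x∈) = there (fits-cover S T U ok x∈)

fits-∪ : ∀ {n} (S T : Subset n) → (∀ {x} → x ∈ S → x ∉ T) → fits S T (S ∪ T) ≡ true
fits-∪ []          []          S∥T = refl
fits-∪ (false ∷ S) (false ∷ T) S∥T = fits-∪ S T λ x∈S x∈T → S∥T (there x∈S) (there x∈T)
fits-∪ (false ∷ S) (true ∷ T)  S∥T = fits-∪ S T λ x∈S x∈T → S∥T (there x∈S) (there x∈T)
fits-∪ (true ∷ S)  (false ∷ T) S∥T = fits-∪ S T λ x∈S x∈T → S∥T (there x∈S) (there x∈T)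
fits-∪ (true ∷ S)  (true ∷ T)  S∥T = ⊥-elim (S∥T here here)

-- Additivity of the degree counted in `B` only: `B = ⊤` gives the ordinary degree, and `B = ∁ A`
-- the second component of the bidegree.
fits-∣∩∣ : ∀ {n} (B S T U : Subset n) → fits S T U ≡ true →
  ∣ S ∩ B ∣ ℕ.+ ∣ T ∩ B ∣ ≡ ∣ U ∩ B ∣
fits-∣∩∣ []          []          []          []          ok = refl
fits-∣∩∣ (b ∷ B)     (false ∷ S) (false ∷ T) (false ∷ U) ok = fits-∣∩∣ B S T U ok
fits-∣∩∣ (true ∷ B)  (true ∷ S)  (false ∷ T) (true ∷ U)  ok = cong suc (fits-∣∩∣ B S T U ok)
fits-∣∩∣ (false ∷ B) (true ∷ S)  (false ∷ T) (true ∷ U)  ok = fits-∣∩∣ B S T U ok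
fits-∣∩∣ (true ∷ B)  (false ∷ S) (true ∷ T)  (true ∷ U)  ok =
  trans (ℕ.+-suc ∣ S ∩ B ∣ ∣ T ∩ B ∣) (cong suc (fits-∣∩∣ B S T U ok))
fits-∣∩∣ (false ∷ B) (false ∷ S) (true ∷ T)  (true ∷ U)  ok = fits-∣∩∣ B S T U ok

fits-∣∣ : ∀ {n} (S T U : Subset n) → fits S T U ≡ true → ∣ S ∣ ℕ.+ ∣ T ∣ ≡ ∣ U ∣
fits-∣∣ S T U ok = begin
  ∣ S ∣ ℕ.+ ∣ T ∣         ≡⟨ cong₂ (λ P Q → ∣ P ∣ ℕ.+ ∣ Q ∣) (∩-identityʳ S) (∩-identityʳ T) ⟨
  ∣ S ∩ ⊤ ∣ ℕ.+ ∣ T ∩ ⊤ ∣ ≡⟨ fits-∣∩∣ ⊤ S T U ok ⟩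
  ∣ U ∩ ⊤ ∣               ≡⟨ cong ∣_∣ (∩-identityʳ U) ⟩
  ∣ U ∣                   ∎
  where open ≡-Reasoning

∣p∣≡0⇒p≡⊥ : ∀ {n} {p : Subset n} → ∣ p ∣ ≡ 0 → p ≡ ⊥
∣p∣≡0⇒p≡⊥ ∣p∣≡0 = Empty-unique λ (x , x∈p) → ℕ.1+n≢0 (trans (suc∣p-x∣≡∣p∣ x∈p) ∣p∣≡0)

fits-unitˡ : ∀ {n} (T U : Subset n) → fits ⊥ T U ≡ true → T ≡ U
fits-unitˡ T U ok = ⊆-antisym (fits-⊆ʳ ⊥ T U ok)
  λ x∈U → subst (_ ∈_) (∪-identityˡ T) (fits-cover ⊥ T U ok x∈U)

fits-⊥ : ∀ {n} (U : Subset n) → fits ⊥ U U ≡ true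
fits-⊥ U = subst (λ V → fits ⊥ U V ≡ true) (∪-identityˡ U) (fits-∪ ⊥ U λ x∈⊥ → ⊥-elim (∉⊥ x∈⊥))

inversions-⊥ˡ : ∀ {n} (T : Subset n) → inversions ⊥ T ≡ 0
inversions-⊥ˡ []          = refl
inversions-⊥ˡ (false ∷ T) = inversions-⊥ˡ T
inversions-⊥ˡ {suc n} (true ∷ T) = cong₂ ℕ._+_ (∣⊥∣≡0 n) (inversions-⊥ˡ T)

inversions-⊥ʳ : ∀ {n} (S : Subset n) → inversions S ⊥ ≡ 0
inversions-⊥ʳ []      = refl
inversions-⊥ʳ (s ∷ S) = inversions-⊥ʳ S

-- Each pair from `S` and `T`, being distinct elements, is inverted in exactly one of the two
-- orders.
inversions-comm : ∀ {n} (S T U : Subset n) → fits S T U ≡ true →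
  inversions S T ℕ.+ inversions T S ≡ ∣ S ∣ ℕ.* ∣ T ∣
inversions-comm []          []          []          ok = refl
inversions-comm (false ∷ S) (false ∷ T) (false ∷ U) ok = inversions-comm S T U ok
inversions-comm (true ∷ S)  (false ∷ T) (true ∷ U)  ok = begin
  inversions S T ℕ.+ (∣ T ∣ ℕ.+ inversions T S) ≡⟨ ℕ+.x∙yz≈y∙xz (inversions S T) ∣ T ∣ _ ⟩
  ∣ T ∣ ℕ.+ (inversions S T ℕ.+ inversions T S) ≡⟨ cong (∣ T ∣ ℕ.+_) (inversions-comm S T U ok) ⟩
  ∣ T ∣ ℕ.+ ∣ S ∣ ℕ.* ∣ T ∣                     ∎
  where open ≡-Reasoning
        module ℕ+ = CommutativeSemigroupProperties ℕ.+-commutativeSemigroup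
inversions-comm (false ∷ S) (true ∷ T)  (true ∷ U)  ok = begin
  (∣ S ∣ ℕ.+ inversions S T) ℕ.+ inversions T S ≡⟨ ℕ.+-assoc ∣ S ∣ _ _ ⟩
  ∣ S ∣ ℕ.+ (inversions S T ℕ.+ inversions T S) ≡⟨ cong (∣ S ∣ ℕ.+_) (inversions-comm S T U ok) ⟩
  ∣ S ∣ ℕ.+ ∣ S ∣ ℕ.* ∣ T ∣                     ≡⟨ ℕ.*-suc ∣ S ∣ ∣ T ∣ ⟨
  ∣ S ∣ ℕ.* suc ∣ T ∣                           ∎
  where open ≡-Reasoning

-- The enumeration of all subsets.

allSubsets-complete : ∀ {n} (S : Subset n) → S ∈ˡ allSubsets n
allSubsets-complete []          = here refl
allSubsets-complete (false ∷ S) = ∈-++⁺ˡ (∈-map⁺ _ (allSubsets-complete S))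
allSubsets-complete (true ∷ S)  = ∈-++⁺ʳ _ (∈-map⁺ _ (allSubsets-complete S))

allSubsets-unique : ∀ n → Unique (allSubsets n)
allSubsets-unique zero    = [] ∷ []
allSubsets-unique (suc n) = Unique.++⁺
  (Unique.map⁺ Vec.∷-injectiveʳ (allSubsets-unique n))
  (Unique.map⁺ Vec.∷-injectiveʳ (allSubsets-unique n))
  λ { (S∈out , S∈in) → disjoint (∈-map⁻ _ S∈out) (∈-map⁻ _ S∈in) }
  where
  disjoint : ∀ {S : Subset (suc n)} → (∃ λ T → T ∈ˡ allSubsets n × S ≡ outside ∷ T) →
             (∃ λ T → T ∈ˡ allSubsets n × S ≡ inside ∷ T) → Data.Empty.⊥
  disjoint (_ , _ , refl) (_ , _ , ())

module ExteriorAlgebra {c ℓ : Level} (K : Field c ℓ) where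
  open Field K renaming
    (refl to ≈-refl; sym to ≈-sym; trans to ≈-trans; reflexive to ≈-reflexive)
    hiding (zero; _-_)
  private
    module +′ = CommutativeSemigroupProperties +-commutativeSemigroup
    module *′ = CommutativeSemigroupProperties *-commutativeSemigroup
  open RingProperties ring using (-‿distribˡ-*; -‿distribʳ-*; -‿involutive)
  open import Relation.Binary.Reasoning.Setoid setoid
  open module Ext {n : ℕ} = Exterior K n using (Elem; _≈ₑ_; 0ₑ; _+ₑ_; _·_; sumE; e; _∧ₑ_; ∂e; Hom)

  private
    variable
      a b : Level
      A : Set a
      B : Set b
      n : ℕ

    sgn : ℕ → ℕ → Carrier
    sgn = Exterior.sgn K

  -- Finite sums

  ∑ : List A → (A → Carrier) → Carrier
  ∑ xs f = foldr (λ x r → f x + r) 0# xs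

  ∑-cong : ∀ (xs : List A) {f g : A → Carrier} → (∀ x → f x ≈ g x) → ∑ xs f ≈ ∑ xs g
  ∑-cong []       f≈g = ≈-refl
  ∑-cong (x ∷ xs) f≈g = +-cong (f≈g x) (∑-cong xs f≈g)

  ∑-zero : ∀ (xs : List A) {f : A → Carrier} → (∀ x → f x ≈ 0#) → ∑ xs f ≈ 0#
  ∑-zero []       f≈0 = ≈-refl
  ∑-zero (x ∷ xs) f≈0 = ≈-trans (+-cong (f≈0 x) (∑-zero xs f≈0)) (+-identityˡ 0#)

  ∑-+ : ∀ (xs : List A) (f g : A → Carrier) → ∑ xs (λ x → f x + g x) ≈ ∑ xs f + ∑ xs g
  ∑-+ []       f g = ≈-sym (+-identityˡ 0#)
  ∑-+ (x ∷ xs) f g = ≈-trans (+-congˡ (∑-+ xs f g)) (+′.interchange (f x) (g x) _ _)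

  ∑-* : ∀ (xs : List A) k (f : A → Carrier) → ∑ xs (λ x → k * f x) ≈ k * ∑ xs f
  ∑-* []       k f = ≈-sym (zeroʳ k)
  ∑-* (x ∷ xs) k f = ≈-trans (+-congˡ (∑-* xs k f)) (≈-sym (distribˡ k (f x) _))

  ∑-comm : ∀ (xs : List A) (ys : List B) (f : A → B → Carrier) →
    ∑ xs (λ x → ∑ ys (f x)) ≈ ∑ ys (λ y → ∑ xs (λ x → f x y))
  ∑-comm []       ys f = ≈-sym (∑-zero ys λ _ → ≈-refl)
  ∑-comm (x ∷ xs) ys f = ≈-trans (+-congˡ (∑-comm xs ys f)) (≈-sym (∑-+ ys (f x) _))

  ∑-++ : ∀ (xs ys : List A) (f : A → Carrier) → ∑ (xs ++ ys) f ≈ ∑ xs f + ∑ ys f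
  ∑-++ []       ys f = ≈-sym (+-identityˡ _)
  ∑-++ (x ∷ xs) ys f = ≈-trans (+-congˡ (∑-++ xs ys f)) (≈-sym (+-assoc _ _ _))

  ∑-map : ∀ (g : A → B) (xs : List A) (f : B → Carrier) → ∑ (map g xs) f ≡ ∑ xs (λ x → f (g x))
  ∑-map g []       f = refl
  ∑-map g (x ∷ xs) f = cong (f (g x) +_) (∑-map g xs f)

  ∑-single : ∀ {xs : List A} {x} {f : A → Carrier} → Unique xs → x ∈ˡ xs →
    (∀ y → y ≢ x → f y ≈ 0#) → ∑ xs f ≈ f x
  ∑-single (x∉xs ∷ _) (here refl) f≈0 = ≈-trans (+-congˡ (rest x∉xs)) (+-identityʳ _)
    where
    rest : ∀ {ys} → All (_ ≢_) ys → ∑ ys _ ≈ 0#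
    rest []           = ≈-refl
    rest (x≢y ∷ x∉ys) = ≈-trans (+-cong (f≈0 _ λ y≡x → x≢y (sym y≡x)) (rest x∉ys)) (+-identityˡ 0#)
  ∑-single (y∉xs ∷ xs!) (there x∈xs) f≈0 = ≈-trans
    (+-cong (f≈0 _ λ { refl → y∉ y∉xs x∈xs }) (∑-single xs! x∈xs f≈0)) (+-identityˡ _)
    where
    y∉ : ∀ {y ys} → All (y ≢_) ys → ¬ (y ∈ˡ ys)
    y∉ (y≢y ∷ _) (here refl) = y≢y refl
    y∉ (_ ∷ ps)  (there y∈)  = y∉ ps y∈

  ∑-allSubsets : ∀ (f : Subset (suc n) → Carrier) → ∑ (allSubsets (suc n)) f ≈
    ∑ (allSubsets n) (λ S → f (outside ∷ S)) + ∑ (allSubsets n) (λ S → f (inside ∷ S))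
  ∑-allSubsets {n} f = ≈-trans (∑-++ (map (outside ∷_) (allSubsets n)) _ f) (≈-reflexive
    (cong₂ _+_ (∑-map (outside ∷_) (allSubsets n) f) (∑-map (inside ∷_) (allSubsets n) f)))

  sumE-at : ∀ (xs : List A) (f : A → Elem {n}) S → sumE xs f S ≡ ∑ xs (λ x → f x S)
  sumE-at []       f S = refl
  sumE-at (x ∷ xs) f S = cong (f x S +_) (sumE-at xs f S)

  -- Signs

  -- Each ambient `n` has its own copy of `sgn`; splitting off the first generator passes from one
  -- copy to another.
  sgn-irrelevant : ∀ m n k → sgn m k ≈ sgn n k
  sgn-irrelevant m n zero    = ≈-refl
  sgn-irrelevant m n (suc k) = -‿cong (sgn-irrelevant m n k)

  sgn-+ : ∀ n i j → sgn n (i ℕ.+ j) ≈ sgn n i * sgn n j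
  sgn-+ n zero    j = ≈-sym (*-identityˡ _)
  sgn-+ n (suc i) j = ≈-trans (-‿cong (sgn-+ n i j)) (-‿distribˡ-* _ _)

  sgn-square : ∀ n k → sgn n k * sgn n k ≈ 1#
  sgn-square n zero    = *-identityˡ 1#
  sgn-square n (suc k) = begin
    - sgn n k * - sgn n k     ≈⟨ -‿distribˡ-* (sgn n k) (- sgn n k) ⟨
    - (sgn n k * - sgn n k)   ≈⟨ -‿cong (-‿distribʳ-* (sgn n k) (sgn n k)) ⟨
    - (- (sgn n k * sgn n k)) ≈⟨ -‿involutive _ ⟩
    sgn n k * sgn n k         ≈⟨ sgn-square n k ⟩
    1#                        ∎

  sgn-cancel : ∀ n k {x} → sgn n k * x ≈ 0# → x ≈ 0#
  sgn-cancel n k {x} eq = begin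
    x                         ≈⟨ *-identityˡ x ⟨
    1# * x                    ≈⟨ *-congʳ (sgn-square n k) ⟨
    (sgn n k * sgn n k) * x   ≈⟨ *-assoc _ _ _ ⟩
    sgn n k * (sgn n k * x)   ≈⟨ *-congˡ eq ⟩
    sgn n k * 0#              ≈⟨ zeroʳ _ ⟩
    0#                        ∎

  sgn≉0 : ∀ n k → ¬ (sgn n k ≈ 0#)
  sgn≉0 n k eq = 0≉1 (≈-trans (≈-sym (zeroʳ _)) (≈-trans (*-congˡ (≈-sym eq)) (sgn-square n k)))

  -- The wedge product

  module _ {n : ℕ} where
    term : (U : Subset n) → Elem → Elem → Subset n → Subset n → Carrier
    term U x y S T = if fits S T U then sgn n (inversions S T) * (x S * y T) else 0#

    term-cong : ∀ {U x y x′ y′} S T → (fits S T U ≡ true → x S * y T ≈ x′ S * y′ T) →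
      term U x y S T ≈ term U x′ y′ S T
    term-cong {U} S T eq with fits S T U
    ... | true  = *-congˡ (eq refl)
    ... | false = ≈-refl

    term-zero : ∀ {U} x y S T → (fits S T U ≡ true → x S * y T ≈ 0#) → term U x y S T ≈ 0#
    term-zero {U} x y S T eq with fits S T U
    ... | true  = ≈-trans (*-congˡ (eq refl)) (zeroʳ _)
    ... | false = ≈-refl

    -- Working at one `U` makes the splitting of `U` into `S` and `T` available, and every later
    -- argument by degree or support rests on it.
    ∧-cong-at : ∀ {x y x′ y′} U → (∀ S T → fits S T U ≡ true → x S * y T ≈ x′ S * y′ T) →
      (x ∧ₑ y) U ≈ (x′ ∧ₑ y′) U
    ∧-cong-at {x} {y} {x′} {y′} U eq =
      ∑-cong (allSubsets n) λ S → ∑-cong (allSubsets n) λ T → term-cong {U} {x} {y} {x′} {y′} S T (eq S T)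

    ∧-zero-at : ∀ {x y} U → (∀ S T → fits S T U ≡ true → x S * y T ≈ 0#) → (x ∧ₑ y) U ≈ 0#
    ∧-zero-at {x} {y} U eq =
      ∑-zero (allSubsets n) λ S → ∑-zero (allSubsets n) λ T → term-zero x y S T (eq S T)

    ∧-cong : ∀ {x y x′ y′ : Elem {n}} → x ≈ₑ x′ → y ≈ₑ y′ → (x ∧ₑ y) ≈ₑ (x′ ∧ₑ y′)
    ∧-cong {x} {y} {x′} {y′} x≈ y≈ U =
      ∧-cong-at {x} {y} {x′} {y′} U λ S T _ → *-cong (x≈ S) (y≈ T)

    ∧-single : ∀ {x y S T U} → fits S T U ≡ true →
      (∀ S′ T′ → fits S′ T′ U ≡ true → ¬ (S′ ≡ S × T′ ≡ T) → x S′ * y T′ ≈ 0#) →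
      (x ∧ₑ y) U ≈ sgn n (inversions S T) * (x S * y T)
    ∧-single {x} {y} {S} {T} {U} ok eq = begin
      (x ∧ₑ y) U
        ≈⟨ ∑-single (allSubsets-unique n) (allSubsets-complete S)
             (λ S′ S′≢S → ∑-zero (allSubsets n) λ T′ →
               term-zero x y S′ T′ λ ok′ → eq S′ T′ ok′ λ (S′≡S , _) → S′≢S S′≡S) ⟩
      ∑ (allSubsets n) (term U x y S)
        ≈⟨ ∑-single (allSubsets-unique n) (allSubsets-complete T)
             (λ T′ T′≢T → term-zero x y S T′ λ ok′ → eq S T′ ok′ λ (_ , T′≡T) → T′≢T T′≡T) ⟩
      term U x y S T
        ≈⟨ ≈-reflexive (cong (if_then _ else 0#) ok) ⟩
      sgn n (inversions S T) * (x S * y T) ∎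

    ∧-+ˡ : ∀ x x′ y U → ((x +ₑ x′) ∧ₑ y) U ≈ (x ∧ₑ y) U + (x′ ∧ₑ y) U
    ∧-+ˡ x x′ y U = ≈-trans
      (∑-cong (allSubsets n) λ S → ≈-trans (∑-cong (allSubsets n) (split S)) (∑-+ (allSubsets n) _ _))
      (∑-+ (allSubsets n) _ _)
      where
      split : ∀ S T → term U (x +ₑ x′) y S T ≈ term U x y S T + term U x′ y S T
      split S T with fits S T U
      ... | true  = ≈-trans (*-congˡ (distribʳ _ _ _)) (distribˡ _ _ _)
      ... | false = ≈-sym (+-identityˡ 0#)

    ∧-+ʳ : ∀ x y y′ U → (x ∧ₑ (y +ₑ y′)) U ≈ (x ∧ₑ y) U + (x ∧ₑ y′) U
    ∧-+ʳ x y y′ U = ≈-trans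
      (∑-cong (allSubsets n) λ S → ≈-trans (∑-cong (allSubsets n) (split S)) (∑-+ (allSubsets n) _ _))
      (∑-+ (allSubsets n) _ _)
      where
      split : ∀ S T → term U x (y +ₑ y′) S T ≈ term U x y S T + term U x y′ S T
      split S T with fits S T U
      ... | true  = ≈-trans (*-congˡ (distribˡ _ _ _)) (distribˡ _ _ _)
      ... | false = ≈-sym (+-identityˡ 0#)

    ∧-·ˡ : ∀ k x y U → ((k · x) ∧ₑ y) U ≈ k * (x ∧ₑ y) U
    ∧-·ˡ k x y U = ≈-trans
      (∑-cong (allSubsets n) λ S → ≈-trans (∑-cong (allSubsets n) (scale S)) (∑-* (allSubsets n) k _))
      (∑-* (allSubsets n) k _)
      where
      scale : ∀ S T → term U (k · x) y S T ≈ k * term U x y S T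
      scale S T with fits S T U
      ... | true  = ≈-trans (*-congˡ (*-assoc _ _ _)) (*′.x∙yz≈y∙xz _ _ _)
      ... | false = ≈-sym (zeroʳ k)

    ∧-·ʳ : ∀ k x y U → (x ∧ₑ (k · y)) U ≈ k * (x ∧ₑ y) U
    ∧-·ʳ k x y U = ≈-trans
      (∧-cong-at {x} {k · y} {k · x} {y} U λ S T _ →
        ≈-trans (*′.x∙yz≈y∙xz _ _ _) (≈-sym (*-assoc _ _ _)))
      (∧-·ˡ k x y U)

    ∧-sumEˡ : ∀ (xs : List A) (f : A → Elem {n}) y → (sumE xs f ∧ₑ y) ≈ₑ sumE xs (λ i → f i ∧ₑ y)
    ∧-sumEˡ []       f y U = ∧-zero-at {0ₑ} {y} U λ _ _ _ → zeroˡ _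
    ∧-sumEˡ (i ∷ xs) f y U = ≈-trans (∧-+ˡ (f i) (sumE xs f) y U) (+-congˡ (∧-sumEˡ xs f y U))

    ∧-sumEʳ : ∀ (xs : List A) x (f : A → Elem {n}) → (x ∧ₑ sumE xs f) ≈ₑ sumE xs (λ i → x ∧ₑ f i)
    ∧-sumEʳ []       x f U = ∧-zero-at {x} {0ₑ} U λ _ _ _ → zeroʳ _
    ∧-sumEʳ (i ∷ xs) x f U = ≈-trans (∧-+ʳ x (f i) (sumE xs f) U) (+-congˡ (∧-sumEʳ xs x f U))

    ∧-comm : ∀ {p q x y} → Hom p x → Hom q y → ∀ U →
      (x ∧ₑ y) U ≈ sgn n (p ℕ.* q) * (y ∧ₑ x) U
    ∧-comm {p} {q} {x} {y} hx hy U = ≈-trans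
      (∑-cong (allSubsets n) λ S → ≈-trans (∑-cong (allSubsets n) (swap S)) (∑-* (allSubsets n) s _))
      (≈-trans (∑-* (allSubsets n) s _) (*-congˡ (∑-comm (allSubsets n) (allSubsets n) _)))
      where
      s = sgn n (p ℕ.* q)
      swap : ∀ S T → term U x y S T ≈ s * term U y x T S
      swap S T with fits S T U in ok | fits T S U in ok′
      ... | true  | false with () ← trans (sym ok) (trans (fits-comm S T U) ok′)
      ... | false | true  with () ← trans (sym ok) (trans (fits-comm S T U) ok′)
      ... | false | false = ≈-sym (zeroʳ s)
      ... | true  | true with ∣ S ∣ ℕ.≟ p | ∣ T ∣ ℕ.≟ q
      ...   | no S≢p | _ = ≈-trans (*-congˡ (≈-trans (*-congʳ (hx S S≢p)) (zeroˡ _))) (≈-trans (zeroʳ _)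
                (≈-sym (≈-trans (*-congˡ (≈-trans (*-congˡ (≈-trans (*-congˡ (hx S S≢p)) (zeroʳ _))) (zeroʳ _))) (zeroʳ s))))
      ...   | yes _ | no T≢q = ≈-trans (*-congˡ (≈-trans (*-congˡ (hy T T≢q)) (zeroʳ _))) (≈-trans (zeroʳ _)
                (≈-sym (≈-trans (*-congˡ (≈-trans (*-congˡ (≈-trans (*-congʳ (hy T T≢q)) (zeroˡ _))) (zeroʳ _))) (zeroʳ s))))
      -- Inserting the square of `sgn n j` lets one copy join `sgn n i` to give `s`, by
      -- `inversions-comm`; the other is the sign of the swapped term.
      ...   | yes refl | yes refl = begin
        sgn n i * (x S * y T)                           ≈⟨ *-cong (*-identityʳ _) (*-comm (y T) (x S)) ⟨
        (sgn n i * 1#) * (y T * x S)                    ≈⟨ *-congʳ (*-congˡ (sgn-square n j)) ⟨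
        (sgn n i * (sgn n j * sgn n j)) * (y T * x S)   ≈⟨ *-congʳ (*-assoc _ _ _) ⟨
        ((sgn n i * sgn n j) * sgn n j) * (y T * x S)   ≈⟨ *-congʳ (*-congʳ (sgn-+ n i j)) ⟨
        (sgn n (i ℕ.+ j) * sgn n j) * (y T * x S)       ≈⟨ *-congʳ (*-congʳ (≈-reflexive (cong (sgn n) (inversions-comm S T U ok)))) ⟩
        (s * sgn n j) * (y T * x S)                     ≈⟨ *-assoc _ _ _ ⟩
        s * (sgn n j * (y T * x S))                     ∎
        where
        i = inversions S T
        j = inversions T S

    e-≡ : ∀ (S : Subset n) → e S S ≈ 1#
    e-≡ S = ≈-reflexive (cong (if_then 1# else 0#) (dec-true (Vec.≡-dec Bool._≟_ S S) refl))

    e-≢ : ∀ {S T : Subset n} → S ≢ T → e S T ≈ 0#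
    e-≢ {S} {T} S≢T = ≈-reflexive (cong (if_then 1# else 0#) (dec-false (Vec.≡-dec Bool._≟_ S T) S≢T))

    ∧-identityˡ : ∀ (x : Elem {n}) → (e ⊥ ∧ₑ x) ≈ₑ x
    ∧-identityˡ x U = begin
      (e ⊥ ∧ₑ x) U                             ≈⟨ ∧-single {e ⊥} {x} (fits-⊥ U) others ⟩
      sgn n (inversions ⊥ U) * (e ⊥ (⊥ {n}) * x U)   ≈⟨ *-cong (≈-reflexive (cong (sgn n) (inversions-⊥ˡ U))) (*-congʳ (e-≡ (⊥ {n}))) ⟩
      1# * (1# * x U)                          ≈⟨ ≈-trans (*-identityˡ _) (*-identityˡ _) ⟩
      x U                                      ∎
      where
      others : ∀ S T → fits S T U ≡ true → ¬ (S ≡ ⊥ × T ≡ U) → e ⊥ S * x T ≈ 0#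
      others S T ok ≢ = ≈-trans (*-congʳ (e-≢ {⊥} {S} λ { refl → ≢ (refl , fits-unitˡ T U ok) })) (zeroˡ _)

    ∧-identityʳ : ∀ (x : Elem {n}) → (x ∧ₑ e ⊥) ≈ₑ x
    ∧-identityʳ x U = begin
      (x ∧ₑ e ⊥) U                             ≈⟨ ∧-single {x} {e ⊥} (trans (fits-comm U ⊥ U) (fits-⊥ U)) others ⟩
      sgn n (inversions U ⊥) * (x U * e ⊥ (⊥ {n}))   ≈⟨ *-cong (≈-reflexive (cong (sgn n) (inversions-⊥ʳ U))) (*-congˡ (e-≡ (⊥ {n}))) ⟩
      1# * (x U * 1#)                          ≈⟨ ≈-trans (*-identityˡ _) (*-identityʳ _) ⟩
      x U                                      ∎
      where
      others : ∀ S T → fits S T U ≡ true → ¬ (S ≡ U × T ≡ ⊥) → x S * e ⊥ T ≈ 0#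
      others S T ok ≢ = ≈-trans
        (*-congˡ (e-≢ {⊥} {T} λ { refl → ≢ (fits-unitˡ S U (trans (fits-comm ⊥ S U) ok) , refl) })) (zeroʳ _)

  -- Associativity, by splitting off the first generator: E ≅ E′ ⊕ e₀ ∧ E′

  out inn : Elem {suc n} → Elem {n}
  out x S = x (outside ∷ S)
  inn x S = x (inside ∷ S)

  -- The grading involution: the sign incurred when a generator moves past `x`.
  invol : Elem {n} → Elem {n}
  invol {n} x S = sgn n ∣ S ∣ * x S

  ∧-[] : ∀ (x y : Elem {0}) → (x ∧ₑ y) [] ≈ x [] * y []
  ∧-[] x y = ≈-trans (+-identityʳ _) (≈-trans (+-identityʳ _) (*-identityˡ _))

  module _ {n : ℕ} where
    private
      L : List (Subset n)
      L = allSubsets n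

      ∑0 : ∑ L (λ _ → 0#) ≈ 0#
      ∑0 = ∑-zero L λ _ → ≈-refl

    ∧-outside : ∀ x y (U : Subset n) → (x ∧ₑ y) (outside ∷ U) ≈ (out x ∧ₑ out y) U
    ∧-outside x y U = begin
      (x ∧ₑ y) (outside ∷ U)
        ≈⟨ ∑-allSubsets (λ S → ∑ (allSubsets (suc n)) (t S)) ⟩
      ∑ L (λ S → ∑ (allSubsets (suc n)) (t (outside ∷ S))) + ∑ L (λ S → ∑ (allSubsets (suc n)) (t (inside ∷ S)))
        ≈⟨ +-cong
             (∑-cong L λ S → ≈-trans (∑-allSubsets (t (outside ∷ S)))
               (≈-trans (+-cong (∑-cong L (restrict S)) ∑0) (+-identityʳ _)))
             (∑-zero L λ S → ≈-trans (∑-allSubsets (t (inside ∷ S)))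
               (≈-trans (+-cong ∑0 ∑0) (+-identityʳ _))) ⟩
      (out x ∧ₑ out y) U + 0#
        ≈⟨ +-identityʳ _ ⟩
      (out x ∧ₑ out y) U ∎
      where
      t = term (outside ∷ U) x y
      restrict : ∀ S T → t (outside ∷ S) (outside ∷ T) ≈ term U (out x) (out y) S T
      restrict S T with fits S T U
      ... | true  = *-congʳ (sgn-irrelevant (suc n) n (inversions S T))
      ... | false = ≈-refl

    -- The first generator comes either from the left factor, at no cost, or from the right one. In
    -- the second case it crosses all of `S`, and `inversions` counts `∣ S ∣`, whence `invol`.
    ∧-inside : ∀ x y (U : Subset n) → (x ∧ₑ y) (inside ∷ U) ≈
      ((inn x ∧ₑ out y) +ₑ (invol (out x) ∧ₑ inn y)) U
    ∧-inside x y U = begin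
      (x ∧ₑ y) (inside ∷ U)
        ≈⟨ ∑-allSubsets (λ S → ∑ (allSubsets (suc n)) (t S)) ⟩
      ∑ L (λ S → ∑ (allSubsets (suc n)) (t (outside ∷ S))) + ∑ L (λ S → ∑ (allSubsets (suc n)) (t (inside ∷ S)))
        ≈⟨ +-cong
             (∑-cong L λ S → ≈-trans (∑-allSubsets (t (outside ∷ S)))
               (≈-trans (+-cong ∑0 (∑-cong L (crossing S))) (+-identityˡ _)))
             (∑-cong L λ S → ≈-trans (∑-allSubsets (t (inside ∷ S)))
               (≈-trans (+-cong (∑-cong L (leading S)) ∑0) (+-identityʳ _))) ⟩
      (invol (out x) ∧ₑ inn y) U + (inn x ∧ₑ out y) U
        ≈⟨ +-comm _ _ ⟩
      ((inn x ∧ₑ out y) +ₑ (invol (out x) ∧ₑ inn y)) U ∎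
      where
      t = term (inside ∷ U) x y
      leading : ∀ S T → t (inside ∷ S) (outside ∷ T) ≈ term U (inn x) (out y) S T
      leading S T with fits S T U
      ... | true  = *-congʳ (sgn-irrelevant (suc n) n (inversions S T))
      ... | false = ≈-refl
      crossing : ∀ S T → t (outside ∷ S) (inside ∷ T) ≈ term U (invol (out x)) (inn y) S T
      crossing S T with fits S T U
      ... | false = ≈-refl
      ... | true  = begin
        sgn (suc n) (k ℕ.+ i) * (x₀ * y₁)     ≈⟨ *-congʳ (sgn-irrelevant (suc n) n (k ℕ.+ i)) ⟩
        sgn n (k ℕ.+ i) * (x₀ * y₁)           ≈⟨ *-congʳ (≈-trans (sgn-+ n k i) (*-comm _ _)) ⟩
        (sgn n i * sgn n k) * (x₀ * y₁)       ≈⟨ *-assoc _ _ _ ⟩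
        sgn n i * (sgn n k * (x₀ * y₁))       ≈⟨ *-congˡ (*-assoc _ _ _) ⟨
        sgn n i * ((sgn n k * x₀) * y₁)       ∎
        where
        k = ∣ S ∣
        i = inversions S T
        x₀ = x (outside ∷ S)
        y₁ = y (inside ∷ T)

    invol-∧ : ∀ (x y : Elem {n}) → invol (x ∧ₑ y) ≈ₑ (invol x ∧ₑ invol y)
    invol-∧ x y U = ≈-trans (≈-sym (∧-·ˡ s x y U))
      (∧-cong-at {x = s · x} {y} {invol x} {invol y} U λ S T ok → begin
        (s * x S) * y T                       ≈⟨ *-assoc _ _ _ ⟩
        s * (x S * y T)                       ≈⟨ *-congʳ (≈-reflexive (cong (sgn n) (sym (fits-∣∣ S T U ok)))) ⟩
        sgn n (∣ S ∣ ℕ.+ ∣ T ∣) * (x S * y T) ≈⟨ *-congʳ (sgn-+ n ∣ S ∣ ∣ T ∣) ⟩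
        (sgn n ∣ S ∣ * sgn n ∣ T ∣) * (x S * y T) ≈⟨ *′.interchange _ _ _ _ ⟩
        (sgn n ∣ S ∣ * x S) * (sgn n ∣ T ∣ * y T) ∎)
      where
      s = sgn n ∣ U ∣

  ∧-assoc : ∀ (x y z : Elem {n}) → ((x ∧ₑ y) ∧ₑ z) ≈ₑ (x ∧ₑ (y ∧ₑ z))
  ∧-assoc x y z [] = begin
    ((x ∧ₑ y) ∧ₑ z) []    ≈⟨ ≈-trans (∧-[] (x ∧ₑ y) z) (*-congʳ (∧-[] x y)) ⟩
    (x [] * y []) * z []  ≈⟨ *-assoc _ _ _ ⟩
    x [] * (y [] * z [])  ≈⟨ ≈-trans (∧-[] x (y ∧ₑ z)) (*-congˡ (∧-[] y z)) ⟨
    (x ∧ₑ (y ∧ₑ z)) []    ∎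
  ∧-assoc x y z (outside ∷ U) = begin
    ((x ∧ₑ y) ∧ₑ z) (outside ∷ U)      ≈⟨ ∧-outside (x ∧ₑ y) z U ⟩
    (out (x ∧ₑ y) ∧ₑ out z) U          ≈⟨ ∧-cong {y = out z} (∧-outside x y) (λ _ → ≈-refl) U ⟩
    ((out x ∧ₑ out y) ∧ₑ out z) U      ≈⟨ ∧-assoc (out x) (out y) (out z) U ⟩
    (out x ∧ₑ (out y ∧ₑ out z)) U      ≈⟨ ∧-cong {x = out x} (λ _ → ≈-refl) (∧-outside y z) U ⟨
    (out x ∧ₑ out (y ∧ₑ z)) U          ≈⟨ ∧-outside x (y ∧ₑ z) U ⟨
    (x ∧ₑ (y ∧ₑ z)) (outside ∷ U)      ∎
  ∧-assoc x y z (inside ∷ U) = begin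
    ((x ∧ₑ y) ∧ₑ z) (inside ∷ U)
      ≈⟨ ∧-inside (x ∧ₑ y) z U ⟩
    (inn (x ∧ₑ y) ∧ₑ z₀) U + (invol (out (x ∧ₑ y)) ∧ₑ z₁) U
      ≈⟨ +-cong (∧-cong {y = z₀} (∧-inside x y) (λ _ → ≈-refl) U)
                (∧-cong {y = z₁} (λ S → ≈-trans (*-congˡ (∧-outside x y S)) (invol-∧ x₀ y₀ S)) (λ _ → ≈-refl) U) ⟩
    (((x₁ ∧ₑ y₀) +ₑ (x̄₀ ∧ₑ y₁)) ∧ₑ z₀) U + ((x̄₀ ∧ₑ ȳ₀) ∧ₑ z₁) U
      ≈⟨ +-congʳ (∧-+ˡ (x₁ ∧ₑ y₀) (x̄₀ ∧ₑ y₁) z₀ U) ⟩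
    (((x₁ ∧ₑ y₀) ∧ₑ z₀) U + ((x̄₀ ∧ₑ y₁) ∧ₑ z₀) U) + ((x̄₀ ∧ₑ ȳ₀) ∧ₑ z₁) U
      ≈⟨ +-assoc _ _ _ ⟩
    ((x₁ ∧ₑ y₀) ∧ₑ z₀) U + (((x̄₀ ∧ₑ y₁) ∧ₑ z₀) U + ((x̄₀ ∧ₑ ȳ₀) ∧ₑ z₁) U)
      ≈⟨ +-cong (∧-assoc x₁ y₀ z₀ U) (+-cong (∧-assoc x̄₀ y₁ z₀ U) (∧-assoc x̄₀ ȳ₀ z₁ U)) ⟩
    (x₁ ∧ₑ (y₀ ∧ₑ z₀)) U + ((x̄₀ ∧ₑ (y₁ ∧ₑ z₀)) U + (x̄₀ ∧ₑ (ȳ₀ ∧ₑ z₁)) U)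
      ≈⟨ +-cong (∧-cong {x = x₁} (λ _ → ≈-refl) (∧-outside y z) U) (∧-+ʳ x̄₀ (y₁ ∧ₑ z₀) (ȳ₀ ∧ₑ z₁) U) ⟨
    (x₁ ∧ₑ out (y ∧ₑ z)) U + (x̄₀ ∧ₑ ((y₁ ∧ₑ z₀) +ₑ (ȳ₀ ∧ₑ z₁))) U
      ≈⟨ +-congˡ (∧-cong {x = x̄₀} (λ _ → ≈-refl) (∧-inside y z) U) ⟨
    (x₁ ∧ₑ out (y ∧ₑ z)) U + (x̄₀ ∧ₑ inn (y ∧ₑ z)) U
      ≈⟨ ∧-inside x (y ∧ₑ z) U ⟨
    (x ∧ₑ (y ∧ₑ z)) (inside ∷ U) ∎
    where
    x₀ = out x
    x₁ = inn x
    x̄₀ = invol (out x)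
    y₀ = out y
    y₁ = inn y
    ȳ₀ = invol (out y)
    z₀ = out z
    z₁ = inn z

  -- The boundary ∂e S

  module _ {n : ℕ} {S T : Subset n} where

    ∂e-zero : (∀ {i} → i ∈ S → S - i ≢ T) → ∂e S T ≈ 0#
    ∂e-zero S-i≢T = ≈-trans (≈-reflexive (sumE-at (allFin n) _ T)) (∑-zero (allFin n) zero-term)
      where
      zero-term : ∀ i → (if lookup S i then sgn n ∣ S ∩ below i ∣ · e (S - i) else 0ₑ) T ≈ 0#
      zero-term i with lookup S i in eq
      ... | true  = ≈-trans (*-congˡ (e-≢ (S-i≢T (Vec.lookup⇒[]= i S eq)))) (zeroʳ _)
      ... | false = ≈-refl

    ∂e-zero-⊈ : ¬ (T ⊆ S) → ∂e S T ≈ 0#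
    ∂e-zero-⊈ T⊈S = ∂e-zero λ { {i} i∈S refl → T⊈S (p─q⊆p S ⁅ i ⁆) }

  -- Distinct elements of `S` have distinct faces, so no other term of the boundary can cancel this
  -- one.
  ∂e-face : ∀ {n} {S : Subset n} {i} → i ∈ S → ∂e S (S - i) ≈ sgn n ∣ S ∩ below i ∣
  ∂e-face {n} {S} {i} i∈S = begin
    ∂e S (S - i)
      ≈⟨ ≈-reflexive (sumE-at (allFin n) _ (S - i)) ⟩
    ∑ (allFin n) (λ j → t j (S - i))
      ≈⟨ ∑-single (Unique.allFin⁺ n) (∈-allFin i) others ⟩
    t i (S - i)
      ≈⟨ ≈-reflexive (cong (λ b → (if b then sgn n ∣ S ∩ below i ∣ · e (S - i) else 0ₑ) (S - i))
                           (Vec.[]=⇒lookup i∈S)) ⟩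
    sgn n ∣ S ∩ below i ∣ * e (S - i) (S - i)
      ≈⟨ ≈-trans (*-congˡ (e-≡ (S - i))) (*-identityʳ _) ⟩
    sgn n ∣ S ∩ below i ∣ ∎
    where
    t : Fin n → Elem
    t j = if lookup S j then sgn n ∣ S ∩ below j ∣ · e (S - j) else 0ₑ
    others : ∀ j → j ≢ i → t j (S - i) ≈ 0#
    others j j≢i with lookup S j in eq
    ... | false = ≈-refl
    ... | true  = ≈-trans (*-congˡ (e-≢ λ S-j≡S-i → j≢i (decidable-stable (j Fin.≟ i) λ _ →
                    proj₂ (∈--⁻ S i (subst (i ∈_) S-j≡S-i (x∈p∧x≢y⇒x∈p-y i∈S λ i≡j → j≢i (sym i≡j)))) refl)))
                  (zeroʳ _)

  ∂e-face≉0 : ∀ {n} (S : Subset n) {i} → i ∈ S → ¬ (∂e S (S - i) ≈ 0#)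
  ∂e-face≉0 {n} S {i} i∈S eq = sgn≉0 n ∣ S ∩ below i ∣ (≈-trans (≈-sym (∂e-face i∈S)) eq)

  ∂e-hom : ∀ {n m} (S : Subset n) → ∣ S ∣ ≡ suc m → Hom m (∂e S)
  ∂e-hom S ∣S∣≡ T ∣T∣≢m = ∂e-zero {S = S} {T} λ { i∈S refl →
    ∣T∣≢m (ℕ.suc-injective (trans (suc∣p-x∣≡∣p∣ i∈S) ∣S∣≡)) }

  -- Evaluates the coefficients of a Koszul syzygy on a family `g`. It serves twice: on the
  -- generators, to see that they form a syzygy, and on the restricted generators, to find the value
  -- `h ∧ f`.
  ∧-combination : ∀ {n} (xs : List A) (u v : A → Carrier) (f h : Elem {n}) (g : A → Elem) U →
    sumE xs (λ i → ((u i · h) +ₑ (v i · f)) ∧ₑ g i) U ≈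
    (h ∧ₑ sumE xs (λ i → u i · g i)) U + (f ∧ₑ sumE xs (λ i → v i · g i)) U
  ∧-combination xs u v f h g U = begin
    sumE xs (λ i → ((u i · h) +ₑ (v i · f)) ∧ₑ g i) U
      ≈⟨ ≈-reflexive (sumE-at xs _ U) ⟩
    ∑ xs (λ i → (((u i · h) +ₑ (v i · f)) ∧ₑ g i) U)
      ≈⟨ ∑-cong xs (λ i → ≈-trans (∧-+ˡ (u i · h) (v i · f) (g i) U) (+-cong (move u h i) (move v f i))) ⟩
    ∑ xs (λ i → (h ∧ₑ (u i · g i)) U + (f ∧ₑ (v i · g i)) U)
      ≈⟨ ∑-+ xs _ _ ⟩
    ∑ xs (λ i → (h ∧ₑ (u i · g i)) U) + ∑ xs (λ i → (f ∧ₑ (v i · g i)) U)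
      ≈⟨ +-cong (collect u h) (collect v f) ⟨
    (h ∧ₑ sumE xs (λ i → u i · g i)) U + (f ∧ₑ sumE xs (λ i → v i · g i)) U ∎
    where
    move : ∀ w x i → ((w i · x) ∧ₑ g i) U ≈ (x ∧ₑ (w i · g i)) U
    move w x i = ≈-trans (∧-·ˡ (w i) x (g i) U) (≈-sym (∧-·ʳ (w i) x (g i) U))
    collect : ∀ w x → (x ∧ₑ sumE xs (λ i → w i · g i)) U ≈ ∑ xs (λ i → (x ∧ₑ (w i · g i)) U)
    collect w x = ≈-trans (∧-sumEʳ xs x (λ i → w i · g i) U) (≈-reflexive (sumE-at xs _ U))

  -- Restriction to a subset of the ground set.

  -- The projection of `E` that sends the generators outside `A` to zero.
  restrict : ∀ {n} → Subset n → Elem {n} → Elem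
  restrict A x S = if does (S ⊆? A) then x S else 0#

  restrict-⊆ : ∀ {n} {A : Subset n} x {S} → S ⊆ A → restrict A x S ≡ x S
  restrict-⊆ {A = A} x {S} S⊆A = cong (if_then x S else 0#) (dec-true (S ⊆? A) S⊆A)

  restrict-⊈ : ∀ {n} {A : Subset n} x {S} → ¬ (S ⊆ A) → restrict A x S ≡ 0#
  restrict-⊈ {A = A} x {S} S⊈A = cong (if_then x S else 0#) (dec-false (S ⊆? A) S⊈A)

-- Linear relations of the Orlik–Solomon ideal

module _ {c ℓ : Level} (K : Field c ℓ) {n : ℕ} (M : Matroid n) (simple : Simple M)
         (L : Exterior.OS.LinearRelations K n M) where
  open Field K renaming
    (refl to ≈-refl; sym to ≈-sym; trans to ≈-trans; reflexive to ≈-reflexive)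
    hiding (zero; _-_)
  open RingProperties ring using (-‿distribˡ-*)
  open import Relation.Binary.Reasoning.Setoid setoid
  open Exterior K n
  open OS M
  open LinearRelations L
  open ExteriorAlgebra K

  private
    infix 4 _≈ᶜ_
    _≈ᶜ_ : Fin n → Fin n → Set
    _≈ᶜ_ = _∼_ M

    x*0 : ∀ {x y} → y ≈ 0# → x * y ≈ 0#
    x*0 y≈0 = ≈-trans (*-congˡ y≈0) (zeroʳ _)

    0*y : ∀ {x y} → x ≈ 0# → x * y ≈ 0#
    0*y x≈0 = ≈-trans (*-congʳ x≈0) (zeroˡ _)

  ∂e∈J : ∀ {S} → Dependent M S → InJ (∂e S)
  ∂e∈J {S} d = (e ⊥ , S , e ⊥) ∷ [] , d ∷ [] , λ U → ≈-sym (begin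
    (e ⊥ ∧ₑ (∂e S ∧ₑ e ⊥)) U + 0# ≈⟨ +-identityʳ _ ⟩
    (e ⊥ ∧ₑ (∂e S ∧ₑ e ⊥)) U      ≈⟨ ∧-identityˡ (∂e S ∧ₑ e ⊥) U ⟩
    (∂e S ∧ₑ e ⊥) U               ≈⟨ ∧-identityʳ (∂e S) U ⟩
    ∂e S U                        ∎)

  J-expansion : ∀ {x} (x∈J : InJ x) T →
    x T ≈ ∑ (allFin r) (λ i → (proj₁ (generates x x∈J) i ∧ₑ gen i) T)
  J-expansion {x} x∈J T = ≈-trans (proj₂ (generates x x∈J) T) (≈-reflexive (sumE-at (allFin r) _ T))

  J-vanishes-below-m : ∀ {x} → InJ x → ∀ T → ∣ T ∣ < m → x T ≈ 0#
  J-vanishes-below-m {x} x∈J T ∣T∣<m = ≈-trans (J-expansion x∈J T)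
    (∑-zero (allFin r) λ i → ∧-zero-at {x = a i} {gen i} T λ P Q ok →
      x*0 (gen-hom i Q (ℕ.<⇒≢ (ℕ.≤-<-trans (p⊆q⇒∣p∣≤∣q∣ (fits-⊆ʳ P Q T ok)) ∣T∣<m))))
    where a = proj₁ (generates x x∈J)

  -- A smaller `S` would give `∂e S` a nonzero coefficient in degree below `m`, where all of `J`
  -- vanishes.
  m<∣dependent∣ : ∀ {S} → Dependent M S → suc m ≤ ∣ S ∣
  m<∣dependent∣ {S} d with suc m ℕ.≤? ∣ S ∣ | dependent-nonempty M d
  ... | yes m<S | _ = m<S
  ... | no m≮S  | i , i∈S = ⊥-elim (∂e-face≉0 S i∈S
          (J-vanishes-below-m (∂e∈J d) (S - i)
            (subst (_≤ m) (sym (suc∣p-x∣≡∣p∣ i∈S)) (ℕ.≮⇒≥ m≮S))))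

  -- Here the defining generators of `J` are used, not `gen`. A product involving `∂e S` reaches `T`
  -- only through a face of `S` inside `T`. That face has at least `m` elements, so it equals `T`,
  -- and `S` has exactly `m + 1`.
  J-support : ∀ {x} → InJ x → ∀ {T} → ∣ T ∣ ≡ m →
    (∀ {S} → Dependent M S → ∣ S ∣ ≡ suc m → ¬ (T ⊆ S)) → x T ≈ 0#
  J-support {x} (ts , deps , x≈) {T} ∣T∣≡m T⊈ = ≈-trans (x≈ T) (sum-zero ts deps)
    where
    face-zero : ∀ {S P} → Dependent M S → P ⊆ T → ∂e S P ≈ 0#
    face-zero {S} {P} d P⊆T = ∂e-zero {S = S} {P} absurd
      where
      absurd : ∀ {i} → i ∈ S → S - i ≢ P
      absurd {i} i∈S refl with ⊆⊎∃∉ T (S - i)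
      ... | inj₁ T⊆S-i = T⊈ d (ℕ.≤-antisym ∣S∣≤1+m (m<∣dependent∣ d)) (⊆-trans T⊆S-i (p─q⊆p S ⁅ i ⁆))
        where
        ∣S∣≤1+m : ∣ S ∣ ≤ suc m
        ∣S∣≤1+m = subst (_≤ suc m) (suc∣p-x∣≡∣p∣ i∈S)
          (s≤s (subst (∣ S - i ∣ ≤_) ∣T∣≡m (p⊆q⇒∣p∣≤∣q∣ P⊆T)))
      ... | inj₂ w = ℕ.n≮n m (ℕ.≤-trans (m<∣dependent∣ d)
        (subst (_≤ m) (suc∣p-x∣≡∣p∣ i∈S) (subst (∣ S - i ∣ <_) ∣T∣≡m (p⊂q⇒∣p∣<∣q∣ (P⊆T , w)))))
    sum-zero : ∀ ts → All (λ t → Dependent M (proj₁ (proj₂ t))) ts →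
      sumE ts (λ t → proj₁ t ∧ₑ (∂e (proj₁ (proj₂ t)) ∧ₑ proj₂ (proj₂ t))) T ≈ 0#
    sum-zero []                 []       = ≈-refl
    sum-zero ((a , S , b) ∷ ts) (d ∷ ds) = ≈-trans (+-cong term-zero′ (sum-zero ts ds)) (+-identityˡ 0#)
      where
      term-zero′ : (a ∧ₑ (∂e S ∧ₑ b)) T ≈ 0#
      term-zero′ = ∧-zero-at {x = a} {∂e S ∧ₑ b} T λ P Q ok → x*0
        (∧-zero-at {x = ∂e S} {b} Q λ Q₁ Q₂ ok′ →
          0*y (face-zero d (⊆-trans (fits-⊆ˡ Q₁ Q₂ Q ok′) (fits-⊆ʳ P Q T ok))))

  minimum-circuit : ∀ {S} → Dependent M S → ∣ S ∣ ≡ suc m → Circuit M S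
  minimum-circuit = minimum-dependent⇒circuit M m<∣dependent∣

  -- This is the splitting of degree `m` of `J` along components: the sets that `J-support` allows
  -- lie inside circuits.
  J-vanishes-on-mixed : ∀ {x} → InJ x → ∀ {T p q} → ∣ T ∣ ≡ m → p ∈ T → q ∈ T → ¬ (p ≈ᶜ q) → x T ≈ 0#
  J-vanishes-on-mixed x∈J ∣T∣≡m p∈T q∈T p≁q = J-support x∈J ∣T∣≡m λ d ∣S∣≡ T⊆S →
    p≁q (circuit⇒∼ M (minimum-circuit d ∣S∣≡) (T⊆S p∈T) (T⊆S q∈T))

  -- Otherwise every generator vanishes on the subsets of `C`: a nonzero coefficient at `Q` would
  -- need a dependent set of size `m + 1` containing `Q`, and a point of `Q` would place that set in
  -- the component of `x`. Then `∂e C`, expanded through the generators, would vanish at the face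
  -- `C - x`.
  component-has-minimum-circuit : ∀ {C x} → Circuit M C → x ∈ C →
    ∃ λ S → Dependent M S × ∣ S ∣ ≡ suc m × S ⊆ component M x
  component-has-minimum-circuit {C} {x} c x∈C
    with anySubset? (λ S → Matroid.indep M S Bool.≟ false ×-dec (∣ S ∣ ℕ.≟ suc m ×-dec S ⊆? component M x))
  ... | yes S = S
  ... | no ¬S = ⊥-elim (∂e-face≉0 C x∈C (≈-trans (J-expansion ∂e∈ (C - x))
          (∑-zero (allFin r) λ i → ∧-zero-at {x = a i} {gen i} (C - x) λ P Q ok →
            x*0 (gen-zero i (⊆-trans (fits-⊆ʳ P Q (C - x) ok) (p─q⊆p C ⁅ x ⁆))))))
    where
    ∂e∈ = ∂e∈J (proj₁ c)
    a   = proj₁ (generates (∂e C) ∂e∈)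
    gen-zero : ∀ i {Q} → Q ⊆ C → gen i Q ≈ 0#
    gen-zero i {Q} Q⊆C with ∣ Q ∣ ℕ.≟ m
    ... | no ∣Q∣≢m  = gen-hom i Q ∣Q∣≢m
    ... | yes ∣Q∣≡m = J-support (gen-in-J i) ∣Q∣≡m absurd
      where
      absurd : ∀ {S} → Dependent M S → ∣ S ∣ ≡ suc m → ¬ (Q ⊆ S)
      absurd {S} d ∣S∣≡ Q⊆S with nonempty? Q
      ... | yes (q , q∈Q) = ¬S (S , d , ∣S∣≡ , λ s∈S → component⁺ M (∼-trans M
              (circuit⇒∼ M c x∈C (Q⊆C q∈Q)) (circuit⇒∼ M (minimum-circuit d ∣S∣≡) (Q⊆S q∈Q) s∈S)))
      -- An empty `Q` gives no point to link `S` to `x`; simplicity excludes it by forcing `m` to be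
      -- at least 2.
      ... | no Q-empty = ℕ.1+n≰n (ℕ.≤-trans (ℕ.≤-trans (s≤s z≤n) (ℕ.s≤s⁻¹ 3≤1+m)) (ℕ.≤-reflexive m≡0))
        where
        3≤1+m : 3 ≤ suc m
        3≤1+m = subst (3 ≤_) ∣S∣≡ (simple⇒3≤∣dependent∣ M simple d)
        m≡0 : m ≡ 0
        m≡0 = trans (sym ∣Q∣≡m) (trans (cong ∣_∣ (Empty-unique Q-empty)) (∣⊥∣≡0 n))

  -- Syzygies and a union of components.

  module _ {A : Subset n} (A-closed : ∀ {p q} → p ∈ A → p ≈ᶜ q → q ∈ A) (2≤m : 2 ≤ m) where

    -- For s linear, Σ sᵢ ∧ gᵢ′ is supported on sets with at most one element
    -- outside A, and Σ sᵢ ∧ (gᵢ - gᵢ′) on sets with at least m outside A.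
    linear-syzygy-restrict : ∀ {s} → Syz s → (∀ i → Hom 1 (s i)) →
      sumFin r (λ i → s i ∧ₑ restrict A (gen i)) ≈ₑ 0ₑ
    linear-syzygy-restrict {s} syz hom U with ∣ U ∩ ∁ A ∣ ℕ.≤? 1
    ... | yes U≤1 = begin
      sumFin r (λ i → s i ∧ₑ restrict A (gen i)) U     ≈⟨ ≈-reflexive (sumE-at (allFin r) _ U) ⟩
      ∑ (allFin r) (λ i → (s i ∧ₑ restrict A (gen i)) U)
        ≈⟨ ∑-cong (allFin r) (λ i → ∧-cong-at {x = s i} {restrict A (gen i)} {s i} {gen i} U
             λ P Q ok → *-congˡ (restrict-gen i P Q ok)) ⟩
      ∑ (allFin r) (λ i → (s i ∧ₑ gen i) U)            ≈⟨ ≈-reflexive (sumE-at (allFin r) _ U) ⟨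
      sumFin r (λ i → s i ∧ₑ gen i) U                  ≈⟨ syz U ⟩
      0#                                               ∎
      where
      -- A `Q` that leaves `A` either mixes components, where generators vanish, or lies wholly
      -- outside `A` and would give `U` at least two outside elements.
      restrict-gen : ∀ i P Q → fits P Q U ≡ true → restrict A (gen i) Q ≈ gen i Q
      restrict-gen i P Q ok with ⊆⊎∃∉ Q A
      ... | inj₁ Q⊆A = ≈-reflexive (restrict-⊆ (gen i) Q⊆A)
      ... | inj₂ (q , q∈Q , q∉A) = ≈-trans (≈-reflexive (restrict-⊈ (gen i) λ Q⊆A → q∉A (Q⊆A q∈Q)))
                                           (≈-sym gen≈0)
        where
        gen≈0 : gen i Q ≈ 0#
        gen≈0 with ∣ Q ∣ ℕ.≟ m | ⊆⊎∃∉ Q (∁ A)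
        ... | no ∣Q∣≢m  | _ = gen-hom i Q ∣Q∣≢m
        ... | yes ∣Q∣≡m | inj₂ (p , p∈Q , p∉∁A) = J-vanishes-on-mixed (gen-in-J i) ∣Q∣≡m p∈Q q∈Q
                λ p∼q → q∉A (A-closed (x∉∁p⇒x∈p p∉∁A) p∼q)
        ... | yes ∣Q∣≡m | inj₁ Q⊆∁A = ⊥-elim (ℕ.n≮n 1 (ℕ.≤-trans 2≤m (ℕ.≤-trans m≤∣U∩∁A∣ U≤1)))
          where
          m≤∣U∩∁A∣ : m ≤ ∣ U ∩ ∁ A ∣
          m≤∣U∩∁A∣ = subst (_≤ ∣ U ∩ ∁ A ∣) ∣Q∣≡m
            (p⊆q⇒∣p∣≤∣q∣ λ x∈Q → x∈p∩q⁺ (fits-⊆ʳ P Q U ok x∈Q , Q⊆∁A x∈Q))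
    ... | no U≰1 = ≈-trans (≈-reflexive (sumE-at (allFin r) _ U))
      (∑-zero (allFin r) λ i → ∧-zero-at {x = s i} {restrict A (gen i)} U (product-zero i))
      where
      -- With `Q` inside `A`, all outside elements of `U` come from `P`, which has just one element.
      product-zero : ∀ i P Q → fits P Q U ≡ true → s i P * restrict A (gen i) Q ≈ 0#
      product-zero i P Q ok with Q ⊆? A | ∣ P ∣ ℕ.≟ 1
      ... | no _    | _         = zeroʳ _
      ... | yes _   | no ∣P∣≢1  = 0*y (hom i P ∣P∣≢1)
      ... | yes Q⊆A | yes ∣P∣≡1 = ⊥-elim (U≰1 (ℕ.≤-trans (ℕ.≤-reflexive ∣U∩∁A∣≡∣P∩∁A∣)
                                    (ℕ.≤-trans (∣p∩q∣≤∣p∣ P (∁ A)) (ℕ.≤-reflexive ∣P∣≡1))))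
        where
        Q∩∁A≡⊥ : Q ∩ ∁ A ≡ ⊥
        Q∩∁A≡⊥ = Empty-unique λ (z , z∈) →
          let z∈Q , z∈∁A = x∈p∩q⁻ Q (∁ A) z∈ in x∈∁p⇒x∉p z∈∁A (Q⊆A z∈Q)
        ∣U∩∁A∣≡∣P∩∁A∣ : ∣ U ∩ ∁ A ∣ ≡ ∣ P ∩ ∁ A ∣
        ∣U∩∁A∣≡∣P∩∁A∣ = trans (sym (fits-∣∩∣ (∁ A) P Q U ok))
          (trans (cong (∣ P ∩ ∁ A ∣ ℕ.+_) (trans (cong ∣_∣ Q∩∁A≡⊥) (∣⊥∣≡0 n))) (ℕ.+-identityʳ _))

    -- The sum is `E`-linear in `a`, by associativity of the wedge product, and the linear syzygies
    -- on which it vanishes generate all syzygies.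
    syzygy-restrict : ∀ {a} → Syz a → sumFin r (λ i → a i ∧ₑ restrict A (gen i)) ≈ₑ 0ₑ
    syzygy-restrict {a} syz U with syz-linear a syz
    ... | k , coef , s , s-syz , s-hom , a≈ = begin
      sumFin r (λ i → a i ∧ₑ g i) U
        ≈⟨ ≈-reflexive (sumE-at (allFin r) _ U) ⟩
      ∑ (allFin r) (λ i → (a i ∧ₑ g i) U)
        ≈⟨ ∑-cong (allFin r) (λ i → begin
             (a i ∧ₑ g i) U
               ≈⟨ ∧-cong {y = g i} (a≈ i) (λ _ → ≈-refl) U ⟩
             (sumFin k (λ j → coef j ∧ₑ s j i) ∧ₑ g i) U
               ≈⟨ ∧-sumEˡ (allFin k) (λ j → coef j ∧ₑ s j i) (g i) U ⟩
             sumFin k (λ j → (coef j ∧ₑ s j i) ∧ₑ g i) U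
               ≈⟨ ≈-reflexive (sumE-at (allFin k) _ U) ⟩
             ∑ (allFin k) (λ j → ((coef j ∧ₑ s j i) ∧ₑ g i) U)
               ≈⟨ ∑-cong (allFin k) (λ j → ∧-assoc (coef j) (s j i) (g i) U) ⟩
             ∑ (allFin k) (λ j → (coef j ∧ₑ (s j i ∧ₑ g i)) U) ∎) ⟩
      ∑ (allFin r) (λ i → ∑ (allFin k) (λ j → (coef j ∧ₑ (s j i ∧ₑ g i)) U))
        ≈⟨ ∑-comm (allFin r) (allFin k) _ ⟩
      ∑ (allFin k) (λ j → ∑ (allFin r) (λ i → (coef j ∧ₑ (s j i ∧ₑ g i)) U))
        ≈⟨ ∑-zero (allFin k) (λ j → begin
             ∑ (allFin r) (λ i → (coef j ∧ₑ (s j i ∧ₑ g i)) U)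
               ≈⟨ ≈-reflexive (sumE-at (allFin r) _ U) ⟨
             sumFin r (λ i → coef j ∧ₑ (s j i ∧ₑ g i)) U
               ≈⟨ ∧-sumEʳ (allFin r) (coef j) (λ i → s j i ∧ₑ g i) U ⟨
             (coef j ∧ₑ sumFin r (λ i → s j i ∧ₑ g i)) U
               ≈⟨ ∧-zero-at {x = coef j} {sumFin r (λ i → s j i ∧ₑ g i)} U
                    (λ P Q _ → x*0 (linear-syzygy-restrict (s-syz j) (s-hom j) Q)) ⟩
             0# ∎) ⟩
      0# ∎
      where
      g : Fin r → Elem
      g i = restrict A (gen i)

  J-degree-m : ∀ {f} → InJ f → Hom m f → ∃ λ (u : Fin r → Carrier) → f ≈ₑ sumFin r (λ i → u i · gen i)
  J-degree-m {f} f∈J hom = u , λ T → ≈-trans (at T) (≈-reflexive (sym (sumE-at (allFin r) _ T)))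
    where
    a = proj₁ (generates f f∈J)
    u : Fin r → Carrier
    -- The coefficients from `generates` may be inhomogeneous; against generators of degree `m`,
    -- only their scalar parts reach degree `m`.
    u i = a i ⊥
    at : ∀ T → f T ≈ ∑ (allFin r) (λ i → u i * gen i T)
    at T with ∣ T ∣ ℕ.≟ m
    ... | no ∣T∣≢m = ≈-trans (hom T ∣T∣≢m) (≈-sym (∑-zero (allFin r) λ i → x*0 (gen-hom i T ∣T∣≢m)))
    ... | yes ∣T∣≡m = ≈-trans (J-expansion f∈J T) (∑-cong (allFin r) λ i → begin
      (a i ∧ₑ gen i) T          ≈⟨ ∧-cong-at {x = a i} {gen i} {u i · e ⊥} {gen i} T (scalar-part i) ⟩
      ((u i · e ⊥) ∧ₑ gen i) T  ≈⟨ ∧-·ˡ (u i) (e ⊥) (gen i) T ⟩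
      u i * (e ⊥ ∧ₑ gen i) T    ≈⟨ *-congˡ (∧-identityˡ (gen i) T) ⟩
      u i * gen i T             ∎)
      where
      scalar-part : ∀ i P Q → fits P Q T ≡ true → a i P * gen i Q ≈ (u i * e ⊥ P) * gen i Q
      scalar-part i P Q ok with ∣ Q ∣ ℕ.≟ m
      ... | no ∣Q∣≢m  = ≈-trans (x*0 (gen-hom i Q ∣Q∣≢m)) (≈-sym (x*0 (gen-hom i Q ∣Q∣≢m)))
      ... | yes ∣Q∣≡m = *-congʳ (at-⊥ P≡⊥)
        where
        at-⊥ : ∀ {P} → P ≡ ⊥ → a i P ≈ u i * e ⊥ P
        at-⊥ refl = ≈-sym (≈-trans (*-congˡ (e-≡ (⊥ {n}))) (*-identityʳ _))
        P≡⊥ : P ≡ ⊥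
        P≡⊥ = ∣p∣≡0⇒p≡⊥ (ℕ.+-cancelʳ-≡ (∣ Q ∣) (∣ P ∣) 0
          (trans (fits-∣∣ P Q T ok) (trans ∣T∣≡m (sym ∣Q∣≡m))))

  sumFin-restrict : ∀ {A f} {u : Fin r → Carrier} → f ≈ₑ sumFin r (λ i → u i · gen i) →
    restrict A f ≈ₑ sumFin r (λ i → u i · restrict A (gen i))
  sumFin-restrict {A} {f} {u} f≈ T = ≈-trans at (≈-reflexive (sym (sumE-at (allFin r) _ T)))
    where
    at : restrict A f T ≈ ∑ (allFin r) (λ i → u i * restrict A (gen i) T)
    at with T ⊆? A
    ... | yes _ = ≈-trans (f≈ T) (≈-reflexive (sumE-at (allFin r) _ T))
    ... | no _  = ≈-sym (∑-zero (allFin r) λ _ → zeroʳ _)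

  no-separated-circuits : ∀ {A S₁ S₂} → (∀ {p q} → p ∈ A → p ≈ᶜ q → q ∈ A) →
    Dependent M S₁ → ∣ S₁ ∣ ≡ suc m → S₁ ⊆ A →
    Dependent M S₂ → ∣ S₂ ∣ ≡ suc m → (∀ {z} → z ∈ S₂ → z ∉ A) → Data.Empty.⊥
  no-separated-circuits {A} {S₁} {S₂} A-closed d₁ ∣S₁∣≡ S₁⊆A d₂ ∣S₂∣≡ S₂∥A
    with dependent-nonempty M d₁ | dependent-nonempty M d₂
  ... | j , j∈S₁ | k , k∈S₂ =
    -- The coefficient of `h ∧ f` at `U` is a product of three signs: one for the shuffle of `T₂`
    -- and `T₁`, and one for each face.
    sgn≉0 n ∣ S₁ ∩ below j ∣ (sgn-cancel n ∣ S₂ ∩ below k ∣ (sgn-cancel n (inversions T₂ T₁) (begin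
    sgn (inversions T₂ T₁) * (sgn ∣ S₂ ∩ below k ∣ * sgn ∣ S₁ ∩ below j ∣)
      ≈⟨ *-congˡ (*-cong (∂e-face k∈S₂) (∂e-face j∈S₁)) ⟨
    sgn (inversions T₂ T₁) * (h T₂ * f T₁)
      ≈⟨ ∧-single {x = h} {f} (fits-∪ T₂ T₁ T₂∥T₁) others ⟨
    (h ∧ₑ f) U
      ≈⟨ h∧f≈0 U ⟩
    0# ∎)))
    where
    f h : Elem
    f = ∂e S₁
    h = ∂e S₂
    T₁ T₂ U : Subset n
    T₁ = S₁ - j
    T₂ = S₂ - k
    U  = T₂ ∪ T₁

    S₂∥S₁ : ∀ {z} → z ∈ S₂ → z ∉ S₁
    S₂∥S₁ z∈S₂ z∈S₁ = S₂∥A z∈S₂ (S₁⊆A z∈S₁)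
    T₁⊆S₁ : T₁ ⊆ S₁
    T₁⊆S₁ = p─q⊆p S₁ ⁅ j ⁆
    T₂⊆S₂ : T₂ ⊆ S₂
    T₂⊆S₂ = p─q⊆p S₂ ⁅ k ⁆
    T₂∥T₁ : ∀ {z} → z ∈ T₂ → z ∉ T₁
    T₂∥T₁ z∈T₂ z∈T₁ = S₂∥S₁ (T₂⊆S₂ z∈T₂) (T₁⊆S₁ z∈T₁)

    -- Since `S₁` and `S₂` are disjoint, `U` splits in only one way into a part of `S₂` and a part
    -- of `S₁`.
    others : ∀ P Q → fits P Q U ≡ true → ¬ (P ≡ T₂ × Q ≡ T₁) → h P * f Q ≈ 0#
    others P Q ok ≢ with P ⊆? S₂ | Q ⊆? S₁
    ... | no P⊈S₂  | _        = 0*y (∂e-zero-⊈ {S = S₂} P⊈S₂)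
    ... | yes _    | no Q⊈S₁  = x*0 (∂e-zero-⊈ {S = S₁} Q⊈S₁)
    ... | yes P⊆S₂ | yes Q⊆S₁ = ⊥-elim (≢
      ( ⊆-antisym (λ z∈P → leftʳ (P⊆S₂ z∈P) (x∈p∪q⁻ T₂ T₁ (fits-⊆ˡ P Q U ok z∈P)))
                  (λ z∈T₂ → left (T₂⊆S₂ z∈T₂) (x∈p∪q⁻ P Q (fits-cover P Q U ok (p⊆p∪q T₁ z∈T₂))))
      , ⊆-antisym (λ z∈Q → rightʳ (Q⊆S₁ z∈Q) (x∈p∪q⁻ T₂ T₁ (fits-⊆ʳ P Q U ok z∈Q)))
                  (λ z∈T₁ → right (T₁⊆S₁ z∈T₁) (x∈p∪q⁻ P Q (fits-cover P Q U ok (q⊆p∪q T₂ T₁ z∈T₁))))))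
      where
      left : ∀ {z} → z ∈ S₂ → z ∈ P ⊎ z ∈ Q → z ∈ P
      left z∈S₂ = [ (λ z∈P → z∈P) , (λ z∈Q → ⊥-elim (S₂∥S₁ z∈S₂ (Q⊆S₁ z∈Q))) ]′
      leftʳ : ∀ {z} → z ∈ S₂ → z ∈ T₂ ⊎ z ∈ T₁ → z ∈ T₂
      leftʳ z∈S₂ = [ (λ z∈T₂ → z∈T₂) , (λ z∈T₁ → ⊥-elim (S₂∥S₁ z∈S₂ (T₁⊆S₁ z∈T₁))) ]′
      right : ∀ {z} → z ∈ S₁ → z ∈ P ⊎ z ∈ Q → z ∈ Q
      right z∈S₁ = [ (λ z∈P → ⊥-elim (S₂∥S₁ (P⊆S₂ z∈P) z∈S₁)) , (λ z∈Q → z∈Q) ]′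
      rightʳ : ∀ {z} → z ∈ S₁ → z ∈ T₂ ⊎ z ∈ T₁ → z ∈ T₁
      rightʳ z∈S₁ = [ (λ z∈T₂ → ⊥-elim (S₂∥S₁ (T₂⊆S₂ z∈T₂) z∈S₁)) , (λ z∈T₁ → z∈T₁) ]′

    2≤m : 2 ≤ m
    2≤m = ℕ.s≤s⁻¹ (subst (3 ≤_) ∣S₁∣≡ (simple⇒3≤∣dependent∣ M simple d₁))

    -- The sign for interchanging two elements of degree `m`.
    ε : Carrier
    ε = sgn (m ℕ.* m)

    f-comb = J-degree-m (∂e∈J d₁) (∂e-hom S₁ ∣S₁∣≡)
    h-comb = J-degree-m (∂e∈J d₂) (∂e-hom S₂ ∣S₂∣≡)
    u v : Fin r → Carrier
    u i = proj₁ f-comb i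
    v i = - ε * proj₁ h-comb i

    -εh≈ : ((- ε) · h) ≈ₑ sumFin r (λ i → v i · gen i)
    -εh≈ T = begin
      - ε * h T
        ≈⟨ *-congˡ (≈-trans (proj₂ h-comb T) (≈-reflexive (sumE-at (allFin r) _ T))) ⟩
      - ε * ∑ (allFin r) (λ i → proj₁ h-comb i * gen i T)
        ≈⟨ ∑-* (allFin r) (- ε) _ ⟨
      ∑ (allFin r) (λ i → - ε * (proj₁ h-comb i * gen i T))
        ≈⟨ ∑-cong (allFin r) (λ i → ≈-sym (*-assoc _ _ _)) ⟩
      ∑ (allFin r) (λ i → v i * gen i T)
        ≈⟨ ≈-reflexive (sumE-at (allFin r) _ T) ⟨
      sumFin r (λ i → v i · gen i) T ∎

    -- The Koszul syzygy in coordinates: `u` expresses `f` and `v` expresses `- ε` times `h`, so the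
    -- sum over the generators is `h ∧ f` minus `ε` times `f ∧ h`.
    a : Fin r → Elem
    a i = (u i · h) +ₑ (v i · f)

    a-syzygy : Syz a
    a-syzygy V = begin
      sumFin r (λ i → a i ∧ₑ gen i) V
        ≈⟨ ∧-combination (allFin r) u v f h gen V ⟩
      (h ∧ₑ sumFin r (λ i → u i · gen i)) V + (f ∧ₑ sumFin r (λ i → v i · gen i)) V
        ≈⟨ +-cong (∧-cong {x = h} (λ _ → ≈-refl) (proj₂ f-comb) V) (∧-cong {x = f} (λ _ → ≈-refl) -εh≈ V) ⟨
      (h ∧ₑ f) V + (f ∧ₑ ((- ε) · h)) V
        ≈⟨ +-cong (∧-comm (∂e-hom S₂ ∣S₂∣≡) (∂e-hom S₁ ∣S₁∣≡) V)
                  (≈-trans (∧-·ʳ (- ε) f h V) (≈-sym (-‿distribˡ-* ε _))) ⟩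
      ε * (f ∧ₑ h) V + - (ε * (f ∧ₑ h) V)
        ≈⟨ -‿inverseʳ _ ⟩
      0# ∎

    f-restrict : restrict A f ≈ₑ f
    f-restrict T with T ⊆? A
    ... | yes _  = ≈-refl
    ... | no T⊈A = ≈-sym (∂e-zero-⊈ {S = S₁} λ T⊆S₁ → T⊈A (⊆-trans T⊆S₁ S₁⊆A))

    -- Only the empty set lies in both `A` and `S₂`, and `h` has no constant term because its degree
    -- `m` is positive.
    -εh-restrict : restrict A ((- ε) · h) ≈ₑ 0ₑ
    -εh-restrict T with T ⊆? A | T ⊆? S₂
    ... | no _    | _        = ≈-refl
    ... | yes _   | no T⊈S₂  = x*0 (∂e-zero-⊈ {S = S₂} T⊈S₂)
    ... | yes T⊆A | yes T⊆S₂ = x*0 (∂e-hom S₂ ∣S₂∣≡ T λ ∣T∣≡m →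
      ℕ.n≮0 (subst (2 ≤_) (trans (sym ∣T∣≡m) ∣T∣≡0) 2≤m))
      where
      ∣T∣≡0 : ∣ T ∣ ≡ 0
      ∣T∣≡0 = trans (cong ∣_∣ (Empty-unique λ (z , z∈T) → S₂∥A (T⊆S₂ z∈T) (T⊆A z∈T))) (∣⊥∣≡0 n)

    h∧f≈0 : (h ∧ₑ f) ≈ₑ 0ₑ
    h∧f≈0 V = begin
      (h ∧ₑ f) V
        ≈⟨ +-identityʳ _ ⟨
      (h ∧ₑ f) V + 0#
        ≈⟨ +-cong (∧-cong {x = h} (λ _ → ≈-refl) f-restrict V)
                  (∧-zero-at {x = f} {restrict A ((- ε) · h)} V λ _ Q _ → x*0 (-εh-restrict Q)) ⟨
      (h ∧ₑ restrict A f) V + (f ∧ₑ restrict A ((- ε) · h)) V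
        ≈⟨ +-cong (∧-cong {x = h} (λ _ → ≈-refl) (sumFin-restrict (proj₂ f-comb)) V)
                  (∧-cong {x = f} (λ _ → ≈-refl) (sumFin-restrict -εh≈) V) ⟩
      (h ∧ₑ sumFin r (λ i → u i · g i)) V + (f ∧ₑ sumFin r (λ i → v i · g i)) V
        ≈⟨ ∧-combination (allFin r) u v f h g V ⟨
      sumFin r (λ i → a i ∧ₑ g i) V
        ≈⟨ syzygy-restrict A-closed 2≤m a-syzygy V ⟩
      0# ∎
      where
      g : Fin r → Elem
      g i = restrict A (gen i)

theorem6p9 : ∀ {c ℓ} (K : Field c ℓ) (n : ℕ) → 1 ≤ n → (M : Matroid n) →
    Simple M → NoSingletonComponents M →
    Exterior.OS.LinearRelations K n M → Connected M
theorem6p9 K (suc n) _ M simple no-singleton L = zero , λ x y →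
  -- Passing to a contradiction makes the doubly negated circuits through `x` and `y` usable. The
  -- component of `x` then serves as `A`.
  decidable-stable (∼-dec M x y) λ x≁y →
    non-singleton M no-singleton x λ (C , c , x∈C) →
    non-singleton M no-singleton y λ (D , d , y∈D) →
    let S₁ , d₁ , ∣S₁∣≡ , S₁⊆ = component-has-minimum-circuit K M simple L c x∈C
        S₂ , d₂ , ∣S₂∣≡ , S₂⊆ = component-has-minimum-circuit K M simple L d y∈D
    in  no-separated-circuits K M simple L
          {A = component M x} (λ p∈A p∼q → component⁺ M (∼-trans M (component⁻ M {x} p∈A) p∼q))
          d₁ ∣S₁∣≡ S₁⊆ d₂ ∣S₂∣≡
          (λ z∈S₂ z∈A → x≁y (∼-trans M (component⁻ M z∈A) (∼-sym M (component⁻ M (S₂⊆ z∈S₂)))))
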